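{- Let $G$ be a connected simple graph with $n=|V(G)|$ vertices and minimum degree $\delta=\delta(G)$, let $k\in(0,n)$ be a real number with $\delta\le\frac{n-k}{2}$, and let $\alpha$ be a real number with $0\le\alpha\le 1$. Each of the following holds. (i) If $\alpha=0$ and $\lambda_1(A_{\alpha}(G))<\delta\sqrt{1+\frac{2k}{n-k}}$, then $\mu_{f}(G)>\frac{n-k}{2}$. (ii) If $0<\alpha\le\frac12$ and $\lambda_1(A_{\alpha}(G))<\frac{2\alpha\delta n}{n-k}$, then $\mu_{f}(G)>\frac{n-k}{2}$. (iii) If $\frac12<\alpha\le 1$ and $\lambda_1(A_{\alpha}(G))<\frac{\alpha\delta(n+k)}{n-k}$, then $\mu_{f}(G)>\frac{n-k}{2}$. (iv) If $\lambda_1(A_{\alpha}(\overline{G}))<\delta+k-1$, then $\mu_{f}(G)>\frac{n-k}{2}$.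
   Context: Graphs are finite, simple and undirected. $\overline{G}$ is the complement of $G$. For a graph $H$ with adjacency matrix $A(H)$ and diagonal degree matrix $D(H)$, and $\alpha\in[0,1]$, put $A_\alpha(H)=\alpha D(H)+(1-\alpha)A(H)$; $\lambda_1(M)$ denotes the largest eigenvalue of a real symmetric matrix $M$. A fractional matching of $G$ is a function $f:E(G)\to[0,1]$ such that for every vertex $v$ the sum of $f(e)$ over all edges $e$ incident with $v$ is at most $1$. The fractional matching number is $\mu_f(G)=\max\{\sum_{e\in E(G)}f(e): f \text{ is a fractional matching of } G\}$. -}

module Defs where

open import Level using (0ℓ)
open import Algebra.Bundles using (CommutativeRing)
open import Data.Bool.Base using (if_then_else_)
open import Data.Fin.Base using (Fin)
open import Data.Fin.Properties using (_≟_; _<?_)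
open import Data.List.Base using (length; filter; map; allFin)
open import Data.List.Extrema.Nat using (min)
open import Data.Nat.Base using (ℕ)
open import Data.Product.Base using (_×_; _,_; ∃-syntax; Σ-syntax)
open import Relation.Binary.Core using (Rel)
open import Relation.Binary.Construct.Closure.ReflexiveTransitive using (Star)
open import Relation.Binary.Definitions using (Decidable; Symmetric)
open import Relation.Binary.PropositionalEquality using (_≢_; refl; ≢-sym)
open import Relation.Binary.Structures using (IsStrictTotalOrder)
import Relation.Binary.Construct.StrictToNonStrict as StrictToNonStrict
open import Relation.Nullary using (¬_; does; ¬?; _×-dec_)
import Algebra.Properties.Semiring.Mult as Mult
import Algebra.Properties.Semiring.Sum as Sum

-- The real numbers, given by their (classically categorical) axioms: a
-- Dedekind-complete totally ordered field.  A statement about ℝ is a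
-- statement about an arbitrary `Reals`.  The inverse is total; nothing is
-- assumed about the inverse of 0#.

record Reals : Set₁ where
  infix  4 _<_
  infix  8 _⁻¹
  infixl 7 _/_

  field
    commutativeRing : CommutativeRing 0ℓ 0ℓ

  open CommutativeRing commutativeRing public

  field
    _⁻¹       : Carrier → Carrier
    ⁻¹-inverse : ∀ x → ¬ (x ≈ 0#) → x * x ⁻¹ ≈ 1#

    _<_                : Rel Carrier 0ℓ
    isStrictTotalOrder : IsStrictTotalOrder _≈_ _<_
    0<1                : 0# < 1#
    +-monoʳ-<          : ∀ x {y z} → y < z → x + y < x + z
    *-positive         : ∀ {x y} → 0# < x → 0# < y → 0# < x * y

  open StrictToNonStrict _≈_ _<_ public using (_≤_)

  UpperBound : (Carrier → Set) → Carrier → Set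
  UpperBound P b = ∀ x → P x → x ≤ b

  field
    supremum : (P : Carrier → Set) → ∃[ x ] P x → ∃[ b ] UpperBound P b →
               ∃[ s ] UpperBound P s × (∀ b → UpperBound P b → s ≤ b)

  _/_ : Carrier → Carrier → Carrier
  x / y = x * y ⁻¹

  fromℕ : ℕ → Carrier
  fromℕ n = Mult._×_ semiring n 1#

  IsSqrtOf : Carrier → Carrier → Set
  IsSqrtOf s x = 0# ≤ s × s * s ≈ x


record Graph (n : ℕ) : Set₁ where
  infix 4 _~_ _~?_
  field
    _~_      : Rel (Fin n) 0ℓ
    _~?_     : Decidable _~_
    ~-sym    : Symmetric _~_
    ~-irrefl : ∀ {v} → ¬ (v ~ v)

module _ {n : ℕ} (G : Graph n) where
  open Graph G

  complement : Graph n
  complement = record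
    { _~_      = λ u v → u ≢ v × ¬ (u ~ v)
    ; _~?_     = λ u v → ¬? (u ≟ v) ×-dec ¬? (u ~? v)
    ; ~-sym    = λ { (u≢v , u≁v) → ≢-sym u≢v , λ v~u → u≁v (~-sym v~u) }
    ; ~-irrefl = λ { (v≢v , _) → v≢v refl }
    }

  Connected : Set
  Connected = ∀ u v → Star _~_ u v

  degree : Fin n → ℕ
  degree v = length (filter (v ~?_) (allFin n))

  -- The default value n is only attained by the graph without vertices,
  -- since all degrees are smaller than n.
  minDegree : ℕ
  minDegree = min n (map degree (allFin n))

module _ ⦃ ℝ : Reals ⦄ where
  open Reals ℝ
  open Sum semiring using (sum)

  Matrix : ℕ → Set
  Matrix n = Fin n → Fin n → Carrier

  IsEigenvalue : ∀ {n} → Matrix n → Carrier → Set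
  IsEigenvalue {n} M ρ =
    Σ[ x ∈ (Fin n → Carrier) ] (∃[ i ] ¬ (x i ≈ 0#)) ×
           (∀ i → sum (λ j → M i j * x j) ≈ ρ * x i)

  IsLargestEigenvalue : ∀ {n} → Matrix n → Carrier → Set
  IsLargestEigenvalue M ρ =
    IsEigenvalue M ρ × (∀ σ → IsEigenvalue M σ → σ ≤ ρ)

  module _ {n : ℕ} (G : Graph n) where
    open Graph G

    adjacencyMatrix : Matrix n
    adjacencyMatrix u v = if does (u ~? v) then 1# else 0#

    degreeMatrix : Matrix n
    degreeMatrix u v = if does (u ≟ v) then fromℕ (degree G u) else 0#

    Aα : Carrier → Matrix n
    Aα α u v = α * degreeMatrix u v + (1# - α) * adjacencyMatrix u v

    -- A function on E(G) is encoded as a symmetric function on pairs of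
    -- vertices that vanishes off the edges; the sum over the edges incident
    -- with v is then the v-th row sum.
    record IsFractionalMatching (f : Fin n → Fin n → Carrier) : Set where
      field
        symmetric   : ∀ u v → f u v ≈ f v u
        off-edges   : ∀ u v → ¬ (u ~ v) → f u v ≈ 0#
        nonneg      : ∀ u v → 0# ≤ f u v
        at-most-one : ∀ u v → f u v ≤ 1#
        vertex-sum  : ∀ v → sum (λ u → f v u) ≤ 1#

  -- Each edge uv is counted once, as the pair with u < v.
  edgeSum : ∀ {n} → (Fin n → Fin n → Carrier) → Carrier
  edgeSum f = sum (λ u → sum (λ v → if does (u <? v) then f u v else 0#))

  IsFractionalMatchingNumber : ∀ {n} → Graph n → Carrier → Set
  IsFractionalMatchingNumber G μ =
    (∃[ f ] IsFractionalMatching G f × edgeSum f ≈ μ) ×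
    (∀ f → IsFractionalMatching G f → edgeSum f ≤ μ)

open Reals ⦃ ... ⦄ public
  using ( Carrier; _≈_; _<_; _≤_; 0#; 1#; _+_; _-_; _*_; _/_
        ; fromℕ; IsSqrtOf )

{-# OPTIONS --safe #-}
-- By König's theorem for the bipartite double cover, a maximum matching M and
-- a cover (L , R) of the same size exist; averaging M with its transpose gives
-- a fractional matching of G of weight |M| / 2.  If μ_f(G) ≤ (n - k) / 2, then
-- S = L ∩ R and T = V ∖ (L ∪ R) satisfy |S| + k ≤ |T|, T is independent, and
-- all neighbours of T lie in S.  Evaluating the quadratic form of A_α on
-- a·1_S + b·1_T (or, for the complement, on the clique T) then bounds λ₁ from
-- below, because at least δ|T| edges join T to S.  With r = (n + k) / (n - k)
-- one has r|S| ≤ |T|, and the choices (a , b) = (√r , 1), (r , 1), (1 , 0) give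
-- the three bounds for G.
--
-- That the largest eigenvalue bounds the Rayleigh quotient needs no compactness.
-- By Schur complements, every symmetric matrix is singular, or has a vector on
-- which its form is negative, or its form is at least ε‖x‖² for some ε > 0.
-- Applied to σ I - M, with σ the supremum of the c such that c‖x‖² is exceeded
-- by the form of M at some x, only the first case is possible, so σ is an
-- eigenvalue.
module Submission where

open import Defs using
  ( Reals; module Reals; Matrix; IsEigenvalue; IsLargestEigenvalue
  ; Graph; module Graph; complement; degree; minDegree
  ; adjacencyMatrix; degreeMatrix; Aα; IsFractionalMatching; edgeSum )
open import Algebra.Bundles using (CommutativeRing)
open import Algebra.Solver.Ring.AlmostCommutativeRing
  using (fromCommutativeRing; _-Raw-AlmostCommutative⟶_)
open import Data.Bool.Base using (Bool; true; false; if_then_else_; _∧_; _∨_; not)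
open import Data.Fin.Base using (Fin; zero; suc) renaming (_<_ to _<ᶠ_)
open import Data.Fin.Properties using (_≟_; any?; suc-injective; <-cmp; _<?_)
open import Data.Integer.Base as ℤ using (ℤ; -[1+_])
open import Data.List.Base using (length; filter; map; allFin; tabulate)
open import Data.List.Extrema.Nat using (min≤xs)
open import Data.List.Membership.Propositional.Properties using (∈-map⁺; ∈-allFin)
open import Data.Maybe.Base using (Maybe; just; nothing)
open import Data.Nat.Base as ℕ using (ℕ; zero; suc; z≤n; s≤s)
open import Data.Product.Base using (_×_; _,_; ∃-syntax; Σ-syntax)
open import Data.Sum.Base as ⊎ using (_⊎_; inj₁; inj₂)
open import Data.Vec.Functional using (_∷_)
open import Function.Base using (_∘_; flip)
open import Relation.Binary.Bundles using (StrictPartialOrder)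
open import Relation.Binary.Definitions using (tri<; tri≈; tri>)
open import Relation.Binary.PropositionalEquality as ≡ using (_≡_; _≢_)
open import Relation.Binary.Structures using (IsStrictTotalOrder)
open import Relation.Nullary using (¬_; Dec; yes; no; does; contradiction; ¬?; _×-dec_)
open import Relation.Nullary.Decidable using (dec-true; dec-false)
import Algebra.Properties.Ring as RingProperties
import Algebra.Properties.Semiring.Mult as Mult
import Algebra.Properties.Semiring.Mult.TCOptimised as MultTCO
import Algebra.Properties.Semiring.Sum as Sum
import Algebra.Solver.Ring
import Data.Bool.Properties as Bool
import Data.Integer.Properties as ℤ
import Data.List.Relation.Unary.All as All
import Data.Nat.Base
import Data.Nat.Properties as ℕ
import Data.Nat.Solver
import Relation.Binary.Construct.StrictToNonStrict as StrictToNonStrict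
import Relation.Binary.Reasoning.Setoid
import Relation.Binary.Reasoning.StrictPartialOrder

-- Ring solver with integer coefficients for an arbitrary commutative ring.

module IntegerCoefficients {c ℓ} (R : CommutativeRing c ℓ) where
  open CommutativeRing R
  open RingProperties ring using (-0#≈0#; -‿involutive; -‿distribˡ-*; -‿distribʳ-*; -‿+-comm)
  open MultTCO semiring using (×ᵤ≈×; 1+×; ×1-homo-*) renaming (_×_ to _·_)
  open Relation.Binary.Reasoning.Setoid setoid

  -- The multiple `·` is the variant for which 1 · 1# reduces to 1#, so that the literals 0 and 1 of
  -- a solver term denote exactly 0# and 1#.
  fromℤ : ℤ → Carrier
  fromℤ (ℤ.+ n)  = n · 1#
  fromℤ -[1+ n ] = - (suc n · 1#)

  fromℤ-neg : ∀ i → fromℤ (ℤ.- i) ≈ - fromℤ i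
  fromℤ-neg ℤ.+0       = sym -0#≈0#
  fromℤ-neg ℤ.+[1+ n ] = refl
  fromℤ-neg -[1+ n ]   = sym (-‿involutive _)

  fromℤ-⊖ : ∀ m n → fromℤ (m ℤ.⊖ n) ≈ m · 1# - n · 1#
  fromℤ-⊖ zero    zero    = sym (-‿inverseʳ 0#)
  fromℤ-⊖ zero    (suc n) = sym (+-identityˡ _)
  fromℤ-⊖ (suc m) zero    = sym (trans (+-congˡ -0#≈0#) (+-identityʳ _))
  fromℤ-⊖ (suc m) (suc n) = begin
    fromℤ (suc m ℤ.⊖ suc n)            ≡⟨ ≡.cong fromℤ (ℤ.[1+m]⊖[1+n]≡m⊖n m n) ⟩
    fromℤ (m ℤ.⊖ n)                    ≈⟨ fromℤ-⊖ m n ⟩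
    x - y                              ≈⟨ +-congʳ (+-identityʳ x) ⟨
    (x + 0#) - y                       ≈⟨ +-congʳ (+-congˡ (-‿inverseʳ 1#)) ⟨
    (x + (1# - 1#)) - y                ≈⟨ +-congʳ (+-assoc x 1# (- 1#)) ⟨
    ((x + 1#) - 1#) - y                ≈⟨ +-assoc (x + 1#) (- 1#) (- y) ⟩
    (x + 1#) + (- 1# - y)              ≈⟨ +-cong (+-comm x 1#) (-‿+-comm 1# y) ⟩
    (1# + x) - (1# + y)                ≈⟨ +-cong (1+× m 1#) (-‿cong (1+× n 1#)) ⟨
    suc m · 1# - suc n · 1#            ∎
    where
    x = m · 1#
    y = n · 1#

  fromℤ-+ : ∀ i j → fromℤ (i ℤ.+ j) ≈ fromℤ i + fromℤ j
  fromℤ-+ (ℤ.+ m)  (ℤ.+ n)  = MultTCO.×-homo-+ semiring 1# m n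
  fromℤ-+ (ℤ.+ m)  -[1+ n ] = fromℤ-⊖ m (suc n)
  fromℤ-+ -[1+ m ] (ℤ.+ n)  = trans (fromℤ-⊖ n (suc m)) (+-comm _ _)
  fromℤ-+ -[1+ m ] -[1+ n ] = begin
    fromℤ (-[1+ m ] ℤ.+ -[1+ n ])         ≡⟨ ≡.cong fromℤ (ℤ.neg-distrib-+ ℤ.+[1+ m ] ℤ.+[1+ n ]) ⟨
    fromℤ (ℤ.- (ℤ.+[1+ m ] ℤ.+ ℤ.+[1+ n ])) ≈⟨ fromℤ-neg (ℤ.+[1+ m ] ℤ.+ ℤ.+[1+ n ]) ⟩
    - ((suc m ℕ.+ suc n) · 1#)            ≈⟨ -‿cong (MultTCO.×-homo-+ semiring 1# (suc m) (suc n)) ⟩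
    - (suc m · 1# + suc n · 1#)           ≈⟨ -‿+-comm _ _ ⟨
    - (suc m · 1#) - suc n · 1#           ∎

  fromℤ-*-+ : ∀ i n → fromℤ (i ℤ.* ℤ.+ n) ≈ fromℤ i * fromℤ (ℤ.+ n)
  fromℤ-*-+ (ℤ.+ m)  n = trans (reflexive (≡.cong fromℤ (≡.sym (ℤ.pos-* m n)))) (×1-homo-* m n)
  fromℤ-*-+ -[1+ m ] n = begin
    fromℤ (-[1+ m ] ℤ.* ℤ.+ n)            ≡⟨ ≡.cong fromℤ (ℤ.neg-distribˡ-* ℤ.+[1+ m ] (ℤ.+ n)) ⟨
    fromℤ (ℤ.- (ℤ.+[1+ m ] ℤ.* ℤ.+ n))    ≈⟨ fromℤ-neg (ℤ.+[1+ m ] ℤ.* ℤ.+ n) ⟩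
    - fromℤ (ℤ.+[1+ m ] ℤ.* ℤ.+ n)        ≈⟨ -‿cong (fromℤ-*-+ ℤ.+[1+ m ] n) ⟩
    - (suc m · 1# * n · 1#)               ≈⟨ -‿distribˡ-* _ _ ⟩
    - (suc m · 1#) * n · 1#               ∎

  fromℤ-* : ∀ i j → fromℤ (i ℤ.* j) ≈ fromℤ i * fromℤ j
  fromℤ-* i (ℤ.+ n)  = fromℤ-*-+ i n
  fromℤ-* i -[1+ n ] = begin
    fromℤ (i ℤ.* -[1+ n ])        ≡⟨ ≡.cong fromℤ (ℤ.neg-distribʳ-* i ℤ.+[1+ n ]) ⟨
    fromℤ (ℤ.- (i ℤ.* ℤ.+[1+ n ])) ≈⟨ fromℤ-neg (i ℤ.* ℤ.+[1+ n ]) ⟩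
    - fromℤ (i ℤ.* ℤ.+[1+ n ])    ≈⟨ -‿cong (fromℤ-*-+ i (suc n)) ⟩
    - (fromℤ i * suc n · 1#)      ≈⟨ -‿distribʳ-* _ _ ⟩
    fromℤ i * - (suc n · 1#)      ∎

  homomorphism : ℤ.+-*-rawRing -Raw-AlmostCommutative⟶ fromCommutativeRing R
  homomorphism = record
    { ⟦_⟧    = fromℤ
    ; +-homo = fromℤ-+
    ; *-homo = fromℤ-*
    ; -‿homo = fromℤ-neg
    ; 0-homo = refl
    ; 1-homo = refl
    }

  fromℤ-≟ : ∀ i j → Maybe (fromℤ i ≈ fromℤ j)
  fromℤ-≟ i j with i ℤ.≟ j
  ... | yes ≡.refl = just refl
  ... | no _       = nothing

  module Solver = Algebra.Solver.Ring _ _ homomorphism fromℤ-≟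

-- Ordered-field arithmetic and finite sums.

module OrderedField ⦃ ℝ : Reals ⦄ where
  open Reals ℝ public hiding (zero)
  open IsStrictTotalOrder isStrictTotalOrder public
    using (compare; isStrictPartialOrder; <-resp-≈; <-respʳ-≈; <-respˡ-≈)
    renaming (trans to <-trans; irrefl to <-irrefl; asym to <-asym)
  open RingProperties ring public using (-0#≈0#)
  open IntegerCoefficients.Solver commutativeRing public
    using (Polynomial; solve; _:=_; con; _:+_; _:*_; _:-_; :-_)
  open Sum semiring public
    using (sum; sum-cong-≋; ∑-distrib-+; ∑-comm; *-distribˡ-sum; *-distribʳ-sum)

  strictPartialOrder : StrictPartialOrder _ _ _
  strictPartialOrder = record { isStrictPartialOrder = isStrictPartialOrder }

  module ≤-Reasoning = Relation.Binary.Reasoning.StrictPartialOrder strictPartialOrder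
  module ≈-Reasoning = Relation.Binary.Reasoning.Setoid setoid

  2# : Carrier
  2# = fromℕ 2

  -- Mirrors the unfolding of `fromℕ 2` as 1# + (1# + 0#), so that solver goals mentioning `2#`
  -- match definitionally.
  :2 : ∀ {m} → Polynomial m
  :2 = con ℤ.1ℤ :+ (con ℤ.1ℤ :+ con ℤ.0ℤ)

  :1 : ∀ {m} → Polynomial m
  :1 = con ℤ.1ℤ

  ≤-refl : ∀ {x} → x ≤ x
  ≤-refl = inj₂ refl

  ≤-trans : ∀ {x y z} → x ≤ y → y ≤ z → x ≤ z
  ≤-trans = StrictToNonStrict.trans _≈_ _<_ isEquivalence <-resp-≈ <-trans

  <-≤-trans : ∀ {x y z} → x < y → y ≤ z → x < z
  <-≤-trans = StrictToNonStrict.<-≤-trans _≈_ _<_ <-trans <-respʳ-≈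

  ≤-<-trans : ∀ {x y z} → x ≤ y → y < z → x < z
  ≤-<-trans = StrictToNonStrict.≤-<-trans _≈_ _<_ sym <-trans <-respˡ-≈

  ≤-<-connex : ∀ x y → x ≤ y ⊎ y < x
  ≤-<-connex x y with compare x y
  ... | tri< x<y _ _ = inj₁ (inj₁ x<y)
  ... | tri≈ _ x≈y _ = inj₁ (inj₂ x≈y)
  ... | tri> _ _ y<x = inj₂ y<x

  ≤⇒≯ : ∀ {x y} → x ≤ y → ¬ (y < x)
  ≤⇒≯ x≤y y<x = <-irrefl refl (≤-<-trans x≤y y<x)

  ≮⇒≥ : ∀ {x y} → ¬ (x < y) → y ≤ x
  ≮⇒≥ {x} {y} x≮y with ≤-<-connex y x
  ... | inj₁ y≤x = y≤x
  ... | inj₂ x<y = contradiction x<y x≮y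

  -- Reduces an estimate to a ring identity: the solver checks x + d ≈ y for an explicit d, and only
  -- the sign of d remains to be argued. Most inequalities below are proved this way.
  ≤-by : ∀ {x y d} → x + d ≈ y → 0# ≤ d → x ≤ y
  ≤-by {x} x+d≈y (inj₁ 0<d) =
    inj₁ (<-respʳ-≈ x+d≈y (<-respˡ-≈ (+-identityʳ x) (+-monoʳ-< x 0<d)))
  ≤-by {x} x+d≈y (inj₂ 0≈d) =
    inj₂ (trans (sym (+-identityʳ x)) (trans (+-congˡ 0≈d) x+d≈y))

  <-by : ∀ {x y d} → x + d ≈ y → 0# < d → x < y
  <-by {x} x+d≈y 0<d = <-respʳ-≈ x+d≈y (<-respˡ-≈ (+-identityʳ x) (+-monoʳ-< x 0<d))

  x+[y-x]≈y : ∀ x y → x + (y - x) ≈ y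
  x+[y-x]≈y = solve 2 (λ x y → x :+ (y :- x) := y) refl

  x<y⇒0<y-x : ∀ {x y} → x < y → 0# < y - x
  x<y⇒0<y-x {x} {y} x<y =
    <-respʳ-≈ (+-comm (- x) y) (<-respˡ-≈ (-‿inverseˡ x) (+-monoʳ-< (- x) x<y))

  x≤y⇒0≤y-x : ∀ {x y} → x ≤ y → 0# ≤ y - x
  x≤y⇒0≤y-x (inj₁ x<y)         = inj₁ (x<y⇒0<y-x x<y)
  x≤y⇒0≤y-x {x} {y} (inj₂ x≈y) = inj₂ (trans (sym (-‿inverseʳ x)) (+-congʳ x≈y))

  +-nonneg : ∀ {x y} → 0# ≤ x → 0# ≤ y → 0# ≤ x + y
  +-nonneg 0≤x 0≤y = ≤-trans 0≤x (≤-by refl 0≤y)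

  +-pos-nonneg : ∀ {x y} → 0# < x → 0# ≤ y → 0# < x + y
  +-pos-nonneg 0<x 0≤y = <-≤-trans 0<x (≤-by refl 0≤y)

  0<x+1 : ∀ {x} → 0# ≤ x → 0# < x + 1#
  0<x+1 {x} 0≤x = <-respʳ-≈ (+-comm 1# x) (+-pos-nonneg 0<1 0≤x)

  *-nonneg : ∀ {x y} → 0# ≤ x → 0# ≤ y → 0# ≤ x * y
  *-nonneg (inj₁ 0<x) (inj₁ 0<y)         = inj₁ (*-positive 0<x 0<y)
  *-nonneg {x} (inj₁ _) (inj₂ 0≈y)       = inj₂ (trans (sym (zeroʳ x)) (*-congˡ 0≈y))
  *-nonneg {_} {y} (inj₂ 0≈x) _          = inj₂ (trans (sym (zeroˡ y)) (*-congʳ 0≈x))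

  0<-x : ∀ {x} → x < 0# → 0# < - x
  0<-x x<0 = <-respʳ-≈ (+-identityˡ _) (x<y⇒0<y-x x<0)

  x²-pos : ∀ {x} → ¬ (x ≈ 0#) → 0# < x * x
  x²-pos {x} x≉0 with compare 0# x
  ... | tri< 0<x _ _ = *-positive 0<x 0<x
  ... | tri≈ _ 0≈x _ = contradiction (sym 0≈x) x≉0
  ... | tri> _ _ x<0 = <-respʳ-≈ (solve 1 (λ x → (:- x) :* (:- x) := x :* x) refl x)
                         (*-positive (0<-x x<0) (0<-x x<0))

  ≈0? : ∀ x → Dec (x ≈ 0#)
  ≈0? x with compare x 0#
  ... | tri< _ x≉0 _ = no x≉0
  ... | tri≈ _ x≈0 _ = yes x≈0
  ... | tri> _ x≉0 _ = no x≉0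

  x²-nonneg : ∀ x → 0# ≤ x * x
  x²-nonneg x with ≈0? x
  ... | yes x≈0 = inj₂ (sym (trans (*-congʳ x≈0) (zeroˡ x)))
  ... | no x≉0  = inj₁ (x²-pos x≉0)

  pos⇒≉0 : ∀ {x} → 0# < x → ¬ (x ≈ 0#)
  pos⇒≉0 0<x x≈0 = <-irrefl (sym x≈0) 0<x

  +-mono-≤ : ∀ {x y u v} → x ≤ y → u ≤ v → x + u ≤ y + v
  +-mono-≤ {x} {y} {u} {v} x≤y u≤v = ≤-by
    (solve 4 (λ x y u v → (x :+ u) :+ ((y :- x) :+ (v :- u)) := y :+ v) refl x y u v)
    (+-nonneg (x≤y⇒0≤y-x x≤y) (x≤y⇒0≤y-x u≤v))

  *-monoˡ-≤ : ∀ c {x y} → 0# ≤ c → x ≤ y → c * x ≤ c * y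
  *-monoˡ-≤ c {x} {y} 0≤c x≤y = ≤-by
    (solve 3 (λ c x y → c :* x :+ c :* (y :- x) := c :* y) refl c x y)
    (*-nonneg 0≤c (x≤y⇒0≤y-x x≤y))

  *-monoʳ-≤ : ∀ c {x y} → 0# ≤ c → x ≤ y → x * c ≤ y * c
  *-monoʳ-≤ c {x} {y} 0≤c x≤y = ≤-by
    (solve 3 (λ c x y → x :* c :+ c :* (y :- x) := y :* c) refl c x y)
    (*-nonneg 0≤c (x≤y⇒0≤y-x x≤y))

  *-monoˡ-< : ∀ c {x y} → 0# < c → x < y → c * x < c * y
  *-monoˡ-< c {x} {y} 0<c x<y = <-by
    (solve 3 (λ c x y → c :* x :+ c :* (y :- x) := c :* y) refl c x y)
    (*-positive 0<c (x<y⇒0<y-x x<y))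

  *-cancelˡ-≤ : ∀ c {x y} → 0# < c → c * x ≤ c * y → x ≤ y
  *-cancelˡ-≤ c {x} {y} 0<c cx≤cy with ≤-<-connex x y
  ... | inj₁ x≤y = x≤y
  ... | inj₂ y<x = contradiction (*-monoˡ-< c 0<c y<x) (≤⇒≯ cx≤cy)

  x⁻¹*x≈1 : ∀ {x} → 0# < x → x ⁻¹ * x ≈ 1#
  x⁻¹*x≈1 {x} 0<x = trans (*-comm _ x) (⁻¹-inverse x (pos⇒≉0 0<x))

  ⁻¹-pos : ∀ {x} → 0# < x → 0# < x ⁻¹
  ⁻¹-pos {x} 0<x with compare 0# (x ⁻¹)
  ... | tri< 0<x⁻¹ _ _ = 0<x⁻¹
  ... | tri≈ _ 0≈x⁻¹ _ = contradiction
    (trans (sym (zeroˡ x)) (trans (*-congʳ 0≈x⁻¹) (x⁻¹*x≈1 0<x)))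
    λ 0≈1 → <-irrefl 0≈1 0<1
  ... | tri> _ _ x⁻¹<0 = contradiction
    (<-respˡ-≈ (⁻¹-inverse x (pos⇒≉0 0<x)) (<-respʳ-≈ (zeroʳ x) (*-monoˡ-< x 0<x x⁻¹<0)))
    (<-asym 0<1)

  /-*-cancel : ∀ x {y} → 0# < y → x / y * y ≈ x
  /-*-cancel x {y} 0<y = trans (*-assoc x _ y) (trans (*-congˡ (x⁻¹*x≈1 0<y)) (*-identityʳ x))

  /-pos : ∀ {x y} → 0# < x → 0# < y → 0# < x / y
  /-pos 0<x 0<y = *-positive 0<x (⁻¹-pos 0<y)

  0<2 : 0# < 2#
  0<2 = +-pos-nonneg 0<1 (inj₁ (+-pos-nonneg 0<1 ≤-refl))

  sum-nonneg : ∀ {n} {f : Fin n → Carrier} → (∀ i → 0# ≤ f i) → 0# ≤ sum f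
  sum-nonneg {zero}  f≥0 = ≤-refl
  sum-nonneg {suc n} f≥0 = +-nonneg (f≥0 zero) (sum-nonneg (f≥0 ∘ suc))

  sum-mono-≤ : ∀ {n} {f g : Fin n → Carrier} → (∀ i → f i ≤ g i) → sum f ≤ sum g
  sum-mono-≤ {zero}  f≤g = ≤-refl
  sum-mono-≤ {suc n} f≤g = +-mono-≤ (f≤g zero) (sum-mono-≤ (f≤g ∘ suc))

  sum-zero : ∀ {n} {f : Fin n → Carrier} → (∀ i → f i ≈ 0#) → sum f ≈ 0#
  sum-zero {zero}  f≈0 = refl
  sum-zero {suc n} f≈0 = trans (+-cong (f≈0 zero) (sum-zero (f≈0 ∘ suc))) (+-identityˡ 0#)

  *-sum : ∀ {n} c (f : Fin n → Carrier) → sum (λ i → c * f i) ≈ c * sum f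
  *-sum c f = sym (*-distribˡ-sum c f)

  sum-linear : ∀ {n} a b (f g : Fin n → Carrier) →
               sum (λ i → a * f i + b * g i) ≈ a * sum f + b * sum g
  sum-linear a b f g = trans (∑-distrib-+ (λ i → a * f i) (λ i → b * g i)) (+-cong (*-sum a f) (*-sum b g))

  sum-≤-term : ∀ {n} {f : Fin n → Carrier} → (∀ i → 0# ≤ f i) → ∀ i → f i ≤ sum f
  sum-≤-term f≥0 zero    = ≤-by refl (sum-nonneg (f≥0 ∘ suc))
  sum-≤-term f≥0 (suc i) = ≤-trans (sum-≤-term (f≥0 ∘ suc) i) (≤-by (+-comm _ _) (f≥0 zero))

  sum-single : ∀ {n} (i : Fin n) (f : Fin n → Carrier) →
               sum (λ j → if does (i ≟ j) then f j else 0#) ≈ f i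
  sum-single {suc n} zero f = trans (+-congˡ (sum-zero {n} (λ _ → refl))) (+-identityʳ (f zero))
  sum-single {suc n} (suc i) f = trans (+-identityˡ _) (sum-single i (f ∘ suc))

-- Quadratic forms of symmetric matrices.

module QuadraticForms ⦃ ℝ : Reals ⦄ where
  open OrderedField ⦃ ℝ ⦄

  Vector : ℕ → Set
  Vector n = Fin n → Carrier

  infix 8 _∙_
  _∙_ : ∀ {n} → Vector n → Vector n → Carrier
  x ∙ y = sum (λ i → x i * y i)

  ‖_‖² : ∀ {n} → Vector n → Carrier
  ‖ x ‖² = x ∙ x

  form : ∀ {n} → Matrix n → Vector n → Carrier
  form M x = x ∙ (λ i → M i ∙ x)

  Symmetric : ∀ {n} → Matrix n → Set
  Symmetric M = ∀ i j → M i j ≈ M j i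

  ‖‖²-nonneg : ∀ {n} (x : Vector n) → 0# ≤ ‖ x ‖²
  ‖‖²-nonneg x = sum-nonneg (λ i → x²-nonneg (x i))

  ‖x‖²≈0⇒x≈0 : ∀ {n} (x : Vector n) → ‖ x ‖² ≈ 0# → ∀ i → x i ≈ 0#
  ‖x‖²≈0⇒x≈0 x ‖x‖²≈0 i with ≈0? (x i)
  ... | yes xᵢ≈0 = xᵢ≈0
  ... | no  xᵢ≉0 = contradiction (x²-pos xᵢ≉0)
    (≤⇒≯ (≤-trans (sum-≤-term (λ j → x²-nonneg (x j)) i) (inj₂ ‖x‖²≈0)))

  ∙-zeroʳ : ∀ {n} (x : Vector n) → x ∙ (λ _ → 0#) ≈ 0#
  ∙-zeroʳ x = sum-zero (λ i → zeroʳ (x i))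

  -- A crude Cauchy-Schwarz inequality: splitting off one coordinate costs a factor 2, by (p + r)² ≤
  -- 2(p² + r²). Any finite constant serves later.
  ∙²-bounded : ∀ {n} (b : Vector n) →
                   ∃[ K ] 0# ≤ K × (∀ y → b ∙ y * b ∙ y ≤ K * ‖ y ‖²)
  ∙²-bounded {zero}  b = 0# , ≤-refl , λ y → inj₂ refl
  ∙²-bounded {suc n} b with ∙²-bounded (b ∘ suc)
  ... | K , 0≤K , bound = K′ , 0≤K′ , bound′
    where
    b₀² = b zero * b zero
    K′ = 2# * (b₀² + K)
    0≤K′ : 0# ≤ K′
    0≤K′ = *-nonneg (inj₁ 0<2) (+-nonneg (x²-nonneg _) 0≤K)
    bound′ : ∀ y → b ∙ y * b ∙ y ≤ K′ * ‖ y ‖²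
    bound′ y = begin
      (p + r) * (p + r)
        ≤⟨ ≤-by (solve 2 (λ p r → (p :+ r) :* (p :+ r) :+ (p :- r) :* (p :- r)
                              := :2 :* (p :* p :+ r :* r)) refl p r)
                (x²-nonneg (p - r)) ⟩
      2# * (p * p + r * r)
        ≤⟨ *-monoˡ-≤ 2# (inj₁ 0<2) (+-mono-≤ ≤-refl (bound (y ∘ suc))) ⟩
      2# * (p * p + K * Y)
        ≤⟨ ≤-by (solve 4 (λ b₀ y₀ K Y →
               :2 :* ((b₀ :* y₀) :* (b₀ :* y₀) :+ K :* Y) :+ :2 :* (b₀ :* b₀ :* Y :+ K :* (y₀ :* y₀))
               := :2 :* (b₀ :* b₀ :+ K) :* (y₀ :* y₀ :+ Y)) refl (b zero) (y zero) K Y)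
             (*-nonneg (inj₁ 0<2) (+-nonneg (*-nonneg (x²-nonneg _) 0≤Y) (*-nonneg 0≤K (x²-nonneg _)))) ⟩
      K′ * (y zero * y zero + Y) ∎
      where
      open ≤-Reasoning
      p = b zero * y zero
      r = (b ∘ suc) ∙ (y ∘ suc)
      Y = ‖ y ∘ suc ‖²
      0≤Y = ‖‖²-nonneg (y ∘ suc)

  sum-combine : ∀ {n} c (f g h : Vector n) → (∀ i → h i ≈ f i + c * g i) →
                sum h ≈ sum f + c * sum g
  sum-combine c f g h h≈ = trans (sum-cong-≋ h≈)
    (trans (∑-distrib-+ f (λ i → c * g i)) (+-congˡ (*-sum c g)))

  -- Block decomposition, Schur complements and completing the square.

  module _ {n} (M : Matrix (suc n)) where
    corner : Carrier
    corner = M zero zero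

    border : Vector n
    border i = M zero (suc i)

    minor : Matrix n
    minor i j = M (suc i) (suc j)

    -- For c the inverse of `corner` this is the Schur complement. Leaving c free keeps the
    -- identities about it polynomial.
    schur : Carrier → Matrix n
    schur c i j = minor i j - c * (border i * border j)

    schur-row : ∀ c y i → schur c i ∙ y ≈ minor i ∙ y + - (c * border ∙ y) * border i
    schur-row c y i = trans
      (sum-combine (- (c * border i)) (λ j → minor i j * y j) (λ j → border j * y j) _
        (λ j → solve 5 (λ m c p q y → (m :- c :* (p :* q)) :* y
                                   := m :* y :+ (:- (c :* p)) :* (q :* y))
                 refl (minor i j) c (border i) (border j) (y j)))
      (+-congˡ (solve 3 (λ c p w → (:- (c :* p)) :* w := (:- (c :* w)) :* p)
                 refl c (border i) (border ∙ y)))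

    form-schur : ∀ c y → form (schur c) y ≈ form minor y - c * (border ∙ y * border ∙ y)
    form-schur c y = trans
      (sum-combine (- (c * w)) (λ i → y i * minor i ∙ y) (λ i → border i * y i) _
        (λ i → trans (*-congˡ (schur-row c y i))
          (solve 4 (λ y m d b → y :* (m :+ d :* b) := y :* m :+ d :* (b :* y))
             refl (y i) (minor i ∙ y) (- (c * w)) (border i))))
      (+-congˡ (solve 2 (λ c w → (:- (c :* w)) :* w := :- (c :* (w :* w))) refl c w))
      where w = border ∙ y

    form-split : Symmetric M → ∀ x₀ y →
                 form M (x₀ ∷ y) ≈ corner * (x₀ * x₀) + 2# * (x₀ * border ∙ y) + form minor y
    form-split M-sym x₀ y = trans
      (+-congˡ (sum-combine x₀ (λ i → y i * minor i ∙ y) (λ i → border i * y i) _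
        (λ i → trans (*-congˡ (+-congʳ (*-congʳ (M-sym (suc i) zero))))
          (solve 4 (λ y b x₀ m → y :* (b :* x₀ :+ m) := y :* m :+ x₀ :* (b :* y))
             refl (y i) (border i) x₀ (minor i ∙ y)))))
      (solve 4 (λ a x₀ w q → x₀ :* (a :* x₀ :+ w) :+ (q :+ x₀ :* w)
                          := a :* (x₀ :* x₀) :+ :2 :* (x₀ :* w) :+ q)
         refl corner x₀ (border ∙ y) (form minor y))

    schur-symmetric : Symmetric M → ∀ c → Symmetric (schur c)
    schur-symmetric M-sym c i j =
      +-cong (M-sym (suc i) (suc j)) (-‿cong (*-congˡ (*-comm _ _)))

    complete-square : Symmetric M → ∀ {c} → corner * c ≈ 1# → ∀ x₀ y →
                      let z = x₀ + c * border ∙ y in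
                      form M (x₀ ∷ y) ≈ corner * (z * z) + form (schur c) y
    complete-square M-sym {c} ac≈1 x₀ y = begin
      form M (x₀ ∷ y)
        ≈⟨ form-split M-sym x₀ y ⟩
      a * (x₀ * x₀) + 2# * (x₀ * w) + q
        -- To the solver a and c are independent; whatever depends on ac ≈ 1 is gathered in the last
        -- summand, which then vanishes.
        ≈⟨ solve 5 (λ a c x₀ w q →
              a :* (x₀ :* x₀) :+ :2 :* (x₀ :* w) :+ q
           := a :* ((x₀ :+ c :* w) :* (x₀ :+ c :* w)) :+ (q :- c :* (w :* w))
              :+ (:1 :- a :* c) :* (:2 :* (x₀ :* w) :+ c :* (w :* w)))
              refl a c x₀ w q ⟩
      a * (z * z) + (q - c * (w * w)) + (1# - a * c) * (2# * (x₀ * w) + c * (w * w))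
        ≈⟨ +-cong (+-congˡ (sym (form-schur c y)))
             (trans (*-congʳ (trans (+-congˡ (-‿cong ac≈1)) (-‿inverseʳ 1#))) (zeroˡ _)) ⟩
      a * (z * z) + form (schur c) y + 0#
        ≈⟨ +-identityʳ _ ⟩
      a * (z * z) + form (schur c) y ∎
      where
      open ≈-Reasoning
      a = corner
      w = border ∙ y
      q = form minor y
      z = x₀ + c * w

  -- `coercive` carries a uniform ε, which mere positivity on nonzero vectors would yield only
  -- through compactness of the sphere. The cases may overlap: a singular matrix can also take
  -- negative values.
  data Definiteness {n} (M : Matrix n) : Set where
    coercive : ∀ ε → 0# < ε → (∀ x → ε * ‖ x ‖² ≤ form M x) → Definiteness M
    singular : ∀ x i → ¬ (x i ≈ 0#) → (∀ j → M j ∙ x ≈ 0#) → Definiteness M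
    negative : ∀ x → form M x < 0# → Definiteness M

  positive-min : ∀ {p q} → 0# < p → 0# < q → ∃[ ε ] 0# < ε × ε ≤ p × ε ≤ q
  positive-min {p} {q} 0<p 0<q with ≤-<-connex p q
  ... | inj₁ p≤q = p , 0<p , ≤-refl , p≤q
  ... | inj₂ q<p = q , 0<q , inj₁ q<p , ≤-refl

  form-zero : ∀ {n} (M : Matrix n) → form M (λ _ → 0#) ≈ 0#
  form-zero M = sum-zero (λ i → zeroˡ (M i ∙ (λ _ → 0#)))

  -- Symmetric Gaussian elimination, by induction on the size and the sign of the corner entry. A
  -- negative corner is itself a value of the form, at the first unit vector; a positive one allows
  -- the square to be completed and passes to the Schur complement.
  definiteness : ∀ {n} (M : Matrix n) → Symmetric M → Definiteness M
  definiteness {zero}  M M-sym = coercive 1# 0<1 (λ _ → inj₂ (zeroʳ 1#))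
  definiteness {suc n} M M-sym with compare (corner M) 0#
  ... | tri< a<0 _ _ = negative (1# ∷ λ _ → 0#)
    (<-respˡ-≈ (sym form≈a) a<0)
    where
    form≈a : form M (1# ∷ λ _ → 0#) ≈ corner M
    form≈a = trans (form-split M M-sym 1# (λ _ → 0#))
      (trans (+-cong (+-congˡ (*-congˡ (*-congˡ (∙-zeroʳ (border M))))) (form-zero (minor M)))
        (solve 1 (λ a → a :* (:1 :* :1) :+ :2 :* (:1 :* con ℤ.0ℤ) :+ con ℤ.0ℤ := a)
           refl (corner M)))
  -- Without a square term the form is affine in the first coordinate. If the border b vanishes, the
  -- first unit vector lies in the kernel; otherwise the form at (t , b) has slope 2‖b‖² in t and
  -- takes negative values.
  ... | tri≈ _ a≈0 _ = corner-zero (≈0? B)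
    where
    b = border M
    B = ‖ b ‖²
    Q = form (minor M) b
    corner-zero : Dec (B ≈ 0#) → Definiteness M
    corner-zero (yes B≈0) = singular (1# ∷ λ _ → 0#) zero (λ 1≈0 → <-irrefl (sym 1≈0) 0<1) λ
      { zero    → trans (+-cong (trans (*-identityʳ _) a≈0) (∙-zeroʳ b)) (+-identityʳ 0#)
      ; (suc i) → trans (+-cong (trans (*-identityʳ _) (trans (M-sym (suc i) zero) (‖x‖²≈0⇒x≈0 b B≈0 i)))
                                (∙-zeroʳ (minor M i)))
                        (+-identityʳ 0#)
      }
    corner-zero (no B≉0) = negative (t ∷ b) (<-respˡ-≈ (sym form≈-1) -1<0)
      where
      0<B : 0# < B
      0<B with compare 0# B
      ... | tri< 0<B _ _ = 0<B
      ... | tri≈ _ 0≈B _ = contradiction (sym 0≈B) B≉0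
      ... | tri> _ _ B<0 = contradiction B<0 (≤⇒≯ (‖‖²-nonneg b))
      0<2B = *-positive 0<2 0<B
      -- Chosen so that the form equals 2 t ‖b‖² + Q = - 1.
      t = (- (Q + 1#)) / (2# * B)
      -1<0 : - 1# < 0#
      -1<0 = <-by (-‿inverseˡ 1#) 0<1
      form≈-1 : form M (t ∷ b) ≈ - 1#
      form≈-1 = begin
        form M (t ∷ b)                        ≈⟨ form-split M M-sym t b ⟩
        corner M * (t * t) + 2# * (t * B) + Q ≈⟨ +-congʳ (+-congʳ (trans (*-congʳ a≈0) (zeroˡ _))) ⟩
        0# + 2# * (t * B) + Q                 ≈⟨ solve 3 (λ t B Q → con ℤ.0ℤ :+ :2 :* (t :* B) :+ Q
                                                  := t :* (:2 :* B) :+ Q) refl t B Q ⟩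
        t * (2# * B) + Q                      ≈⟨ +-congʳ (/-*-cancel (- (Q + 1#)) 0<2B) ⟩
        - (Q + 1#) + Q                        ≈⟨ solve 1 (λ Q → :- (Q :+ :1) :+ Q := :- :1) refl Q ⟩
        - 1#                                  ∎
        where open ≈-Reasoning
  ... | tri> _ _ 0<a with definiteness (schur M (corner M ⁻¹)) (schur-symmetric M M-sym (corner M ⁻¹))
  -- The first coordinate - (c * w) annihilates the completed square, and also the first row of `M`
  -- applied to the vector. Hence negative and singular witnesses for the Schur complement both lift
  -- to `M`.
  ... | negative y Ny<0 = negative (- (c * w) ∷ y) (<-respˡ-≈ (sym form≈) Ny<0)
    where
    a = corner M
    c = a ⁻¹
    w = border M ∙ y
    form≈ : form M (- (c * w) ∷ y) ≈ form (schur M c) y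
    form≈ = trans (complete-square M M-sym (⁻¹-inverse a (pos⇒≉0 0<a)) (- (c * w)) y)
      (trans (+-congʳ (trans (*-congˡ (trans (*-congʳ (-‿inverseˡ (c * w))) (zeroˡ _))) (zeroʳ a)))
        (+-identityˡ _))
  ... | singular y i yᵢ≉0 Ny≈0 = singular (- (c * w) ∷ y) (suc i) yᵢ≉0 λ
      { zero    → trans (solve 3 (λ a c w → a :* (:- (c :* w)) :+ w := (:1 :- a :* c) :* w) refl a c w)
                    (trans (*-congʳ (trans (+-congˡ (-‿cong (⁻¹-inverse a (pos⇒≉0 0<a)))) (-‿inverseʳ 1#)))
                      (zeroˡ w))
      ; (suc j) → trans (+-congʳ (*-congʳ (M-sym (suc j) zero)))
                    (trans (solve 3 (λ b d m → b :* d :+ m := m :+ d :* b) refl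
                              (border M j) (- (c * w)) (minor M j ∙ y))
                      (trans (sym (schur-row M c y j)) (Ny≈0 j)))
      }
    where
    a = corner M
    c = a ⁻¹
    w = border M ∙ y
  ... | coercive ε′ 0<ε′ N≥ with ∙²-bounded (border M)
  ... | K , 0≤K , w²≤
    -- Two constraints on ε: 2ε ≤ a pays for the term 2z², and εH ≤ ε′ with H = 2c²K + 1 pays for
    -- 2c²w² + ‖y‖², as w² ≤ K‖y‖².
    with positive-min {corner M / 2#} {ε′ / (2# * (corner M ⁻¹ * corner M ⁻¹ * K) + 1#)}
      (/-pos 0<a 0<2)
      (/-pos 0<ε′ (0<x+1 (*-nonneg (inj₁ 0<2) (*-nonneg (x²-nonneg (corner M ⁻¹)) 0≤K))))
  ... | ε , 0<ε , ε≤a/2 , ε≤ε′/H = coercive ε 0<ε bound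
    where
    a = corner M
    c = a ⁻¹
    H = 2# * (c * c * K) + 1#
    0<H : 0# < H
    0<H = 0<x+1 (*-nonneg (inj₁ 0<2) (*-nonneg (x²-nonneg c) 0≤K))
    ε2≤a : ε * 2# ≤ a
    ε2≤a = ≤-trans (*-monoʳ-≤ 2# (inj₁ 0<2) ε≤a/2) (inj₂ (/-*-cancel a 0<2))
    εH≤ε′ : ε * H ≤ ε′
    εH≤ε′ = ≤-trans (*-monoʳ-≤ H (inj₁ 0<H) ε≤ε′/H) (inj₂ (/-*-cancel ε′ 0<H))
    bound : ∀ x → ε * ‖ x ‖² ≤ form M x
    bound x = begin
      ε * (x₀ * x₀ + Y)
        -- Since x₀ = z - cw, this is x₀² ≤ 2z² + 2(cw)²; the difference is the square of z + cw.
        ≤⟨ *-monoˡ-≤ ε (inj₁ 0<ε) (≤-by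
             (solve 4 (λ x₀ c w Y →
                (x₀ :* x₀ :+ Y) :+ (x₀ :+ :2 :* (c :* w)) :* (x₀ :+ :2 :* (c :* w))
                := :2 :* ((x₀ :+ c :* w) :* (x₀ :+ c :* w)) :+ (:2 :* (c :* c :* (w :* w)) :+ Y))
                refl x₀ c w Y)
             (x²-nonneg _)) ⟩
      ε * (2# * (z * z) + (2# * (c * c * (w * w)) + Y))
        ≤⟨ *-monoˡ-≤ ε (inj₁ 0<ε) (+-mono-≤ ≤-refl (+-mono-≤
             (*-monoˡ-≤ 2# (inj₁ 0<2) (*-monoˡ-≤ (c * c) (x²-nonneg c) (w²≤ y))) ≤-refl)) ⟩
      ε * (2# * (z * z) + (2# * (c * c * (K * Y)) + Y))
        ≈⟨ solve 5 (λ ε Z k K Y →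
              ε :* (:2 :* Z :+ (:2 :* (k :* (K :* Y)) :+ Y))
              := (ε :* :2) :* Z :+ (ε :* (:2 :* (k :* K) :+ :1)) :* Y)
            refl ε (z * z) (c * c) K Y ⟩
      (ε * 2#) * (z * z) + (ε * H) * Y
        ≤⟨ +-mono-≤ (*-monoʳ-≤ (z * z) (x²-nonneg z) ε2≤a)
                    (*-monoʳ-≤ Y (‖‖²-nonneg y) εH≤ε′) ⟩
      a * (z * z) + ε′ * Y
        ≤⟨ +-mono-≤ ≤-refl (N≥ y) ⟩
      a * (z * z) + form (schur M c) y
        ≈⟨ complete-square M M-sym (⁻¹-inverse a (pos⇒≉0 0<a)) x₀ y ⟨
      form M x ∎
      where
      open ≤-Reasoning
      x₀ = x zero
      y = x ∘ suc
      Y = ‖ y ‖²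
      w = border M ∙ y
      z = x₀ + c * w

  -- Upper bounds for quadratic forms.

  nonneg-bound : ∀ a → ∃[ A ] 0# ≤ A × a ≤ A
  nonneg-bound a with ≤-<-connex a 0#
  ... | inj₁ a≤0 = 0# , ≤-refl , a≤0
  ... | inj₂ 0<a = a , inj₁ 0<a , ≤-refl

  -- Supplies the upper bound that a supremum requires. The mixed term is absorbed by 2x₀w ≤ x₀² +
  -- w², and the corner is replaced by a nonnegative majorant so that every coefficient is
  -- nonnegative.
  form-bounded : ∀ {n} (M : Matrix n) → Symmetric M →
                 ∃[ B ] 0# ≤ B × (∀ x → form M x ≤ B * ‖ x ‖²)
  form-bounded {zero}  M M-sym = 0# , ≤-refl , λ _ → inj₂ (sym (zeroˡ 0#))
  form-bounded {suc n} M M-sym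
    with form-bounded (minor M) (λ i j → M-sym (suc i) (suc j))
       | ∙²-bounded (border M)
       | nonneg-bound (corner M)
  ... | B , 0≤B , Q≤ | K , 0≤K , w²≤ | A , 0≤A , a≤A = B′ , 0≤B′ , bound
    where
    a = corner M
    B′ = A + 1# + K + B
    0≤B′ : 0# ≤ B′
    0≤B′ = +-nonneg (+-nonneg (+-nonneg 0≤A (inj₁ 0<1)) 0≤K) 0≤B
    bound : ∀ x → form M x ≤ B′ * ‖ x ‖²
    bound x = begin
      form M x
        ≈⟨ form-split M M-sym x₀ y ⟩
      a * X + 2# * (x₀ * w) + form (minor M) y
        ≤⟨ +-mono-≤ (≤-by (solve 3 (λ a x₀ w →
               (a :* (x₀ :* x₀) :+ :2 :* (x₀ :* w)) :+ (x₀ :- w) :* (x₀ :- w)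
               := a :* (x₀ :* x₀) :+ x₀ :* x₀ :+ w :* w) refl a x₀ w) (x²-nonneg (x₀ - w)))
             (Q≤ y) ⟩
      a * X + X + w * w + B * Y
        ≤⟨ +-mono-≤ (+-mono-≤ ≤-refl (w²≤ y)) ≤-refl ⟩
      a * X + X + K * Y + B * Y
        ≤⟨ ≤-by (solve 6 (λ a A X K B Y →
               (a :* X :+ X :+ K :* Y :+ B :* Y)
                 :+ ((A :- a) :* X :+ (K :+ B) :* X :+ (A :+ :1) :* Y)
               := (A :+ :1 :+ K :+ B) :* (X :+ Y)) refl a A X K B Y)
             (+-nonneg (+-nonneg (*-nonneg (x≤y⇒0≤y-x a≤A) (x²-nonneg x₀))
               (*-nonneg (+-nonneg 0≤K 0≤B) (x²-nonneg x₀)))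
               (*-nonneg (+-nonneg 0≤A (inj₁ 0<1)) (‖‖²-nonneg y))) ⟩
      B′ * (X + Y) ∎
      where
      open ≤-Reasoning
      x₀ = x zero
      X = x₀ * x₀
      y = x ∘ suc
      Y = ‖ y ‖²
      w = border M ∙ y

  identity : ∀ {n} → Matrix n
  identity i j = if does (i ≟ j) then 1# else 0#

  identity-symmetric : ∀ {n} → Symmetric (identity {n})
  identity-symmetric i j with i ≟ j | j ≟ i
  ... | yes _   | yes _   = refl
  ... | no _    | no _    = refl
  ... | yes i≡j | no j≢i  = contradiction (≡.sym i≡j) j≢i
  ... | no i≢j  | yes j≡i = contradiction (≡.sym j≡i) i≢j

  identity-row : ∀ {n} i (x : Vector n) → identity i ∙ x ≈ x i
  identity-row i x = trans (sum-cong-≋ pointwise) (sum-single i x)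
    where
    pointwise : ∀ j → identity i j * x j ≈ (if does (i ≟ j) then x j else 0#)
    pointwise j with i ≟ j
    ... | yes _ = *-identityˡ (x j)
    ... | no  _ = zeroˡ (x j)

  -- The supremum of the Rayleigh quotients as an eigenvalue.

  module _ {n} (M : Matrix n) (M-sym : Symmetric M) where
    shifted : Carrier → Matrix n
    shifted σ i j = σ * identity i j - M i j

    shifted-symmetric : ∀ σ → Symmetric (shifted σ)
    shifted-symmetric σ i j = +-cong (*-congˡ (identity-symmetric i j)) (-‿cong (M-sym i j))

    shifted-row : ∀ σ x i → shifted σ i ∙ x ≈ σ * x i - M i ∙ x
    shifted-row σ x i = trans
      (sum-combine (- 1#) (λ j → σ * (identity i j * x j)) (λ j → M i j * x j) _
        (λ j → solve 4 (λ σ e m x → (σ :* e :- m) :* x := σ :* (e :* x) :+ (:- :1) :* (m :* x))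
                 refl σ (identity i j) (M i j) (x j)))
      (+-cong (trans (*-sum σ (λ j → identity i j * x j)) (*-congˡ (identity-row i x)))
              (solve 1 (λ y → (:- :1) :* y := :- y) refl (M i ∙ x)))

    form-shifted : ∀ σ x → form (shifted σ) x ≈ σ * ‖ x ‖² - form M x
    form-shifted σ x = trans
      (sum-combine (- 1#) (λ i → σ * (x i * x i)) (λ i → x i * M i ∙ x) _
        (λ i → trans (*-congˡ (shifted-row σ x i))
          (solve 3 (λ σ x y → x :* (σ :* x :- y) := σ :* (x :* x) :+ (:- :1) :* (x :* y))
             refl σ (x i) (M i ∙ x))))
      (+-cong (*-sum σ (λ i → x i * x i)) (solve 1 (λ y → (:- :1) :* y := :- y) refl (form M x)))

    -- The numbers strictly below some Rayleigh quotient. Strictness excludes x = 0, where both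
    -- sides vanish, so nothing has to be normalised.
    Exceeded : Carrier → Set
    Exceeded c = Σ[ x ∈ Vector n ] c * ‖ x ‖² < form M x

    exceeded-bounded : ∃[ B ] UpperBound Exceeded B
    exceeded-bounded with form-bounded M M-sym
    ... | B , _ , form≤ = B , λ c (x , c‖x‖²<form) → ≮⇒≥ λ B<c →
      ≤⇒≯ (≤-trans (form≤ x) (*-monoʳ-≤ ‖ x ‖² (‖‖²-nonneg x) (inj₁ B<c))) c‖x‖²<form

    -- Consequently the supremum does not belong to the set, and every member lies strictly below
    -- it.
    exceeded-open : ∀ c → Exceeded c → ∃[ c′ ] c < c′ × Exceeded c′
    exceeded-open c (x , c‖x‖²<form) = c + η , <-by refl 0<η , x , (begin-strict
      (c + η) * ‖ x ‖²                       <⟨ <-by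
        (solve 3 (λ c η Y → (c :+ η) :* Y :+ η := c :* Y :+ η :* (Y :+ :1)) refl c η ‖ x ‖²) 0<η ⟩
      c * ‖ x ‖² + η * (‖ x ‖² + 1#)         ≈⟨ +-congˡ (/-*-cancel d 0<Y+1) ⟩
      c * ‖ x ‖² + d                         ≈⟨ x+[y-x]≈y _ _ ⟩
      form M x                               ∎)
      where
      open ≤-Reasoning
      d = form M x - c * ‖ x ‖²
      0<Y+1 : 0# < ‖ x ‖² + 1#
      0<Y+1 = 0<x+1 (‖‖²-nonneg x)
      -- The + 1# makes the denominator positive and leaves exactly η of slack, which gives
      -- strictness.
      η = d / (‖ x ‖² + 1#)
      0<η : 0# < η
      0<η = /-pos (x<y⇒0<y-x c‖x‖²<form) 0<Y+1

    -- Let σ be the supremum. A negative value of the form of σI - M would make σ exceeded, though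
    -- the set has no greatest element; coercivity would make σ - ε a smaller upper bound. A kernel
    -- vector of σI - M remains, which is an eigenvector.
    exceeded⇒eigenvalue : ∀ ρ → Exceeded ρ → ∃[ σ ] ρ < σ × IsEigenvalue M σ
    exceeded⇒eigenvalue ρ ρ-exceeded
      with supremum Exceeded (ρ , ρ-exceeded) exceeded-bounded
    ... | σ , σ-upper , σ-least with definiteness (shifted σ) (shifted-symmetric σ)
    ... | singular x i xᵢ≉0 Nx≈0 = σ , below ρ ρ-exceeded , x , (i , xᵢ≉0) , λ j → begin
      M j ∙ x                        ≈⟨ solve 2 (λ m s → m := s :- (s :- m)) refl (M j ∙ x) (σ * x j) ⟩
      σ * x j - (σ * x j - M j ∙ x)  ≈⟨ +-congˡ (-‿cong (trans (sym (shifted-row σ x j)) (Nx≈0 j))) ⟩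
      σ * x j - 0#                   ≈⟨ trans (+-congˡ -0#≈0#) (+-identityʳ _) ⟩
      σ * x j                        ∎
      where
      open ≈-Reasoning
      below : ∀ c → Exceeded c → c < σ
      below c c-exceeded with exceeded-open c c-exceeded
      ... | c′ , c<c′ , c′-exceeded = <-≤-trans c<c′ (σ-upper c′ c′-exceeded)
    ... | negative x Nx<0 =
      let c , σ<c , c-exceeded = exceeded-open σ σ-exceeded
      in contradiction σ<c (≤⇒≯ (σ-upper c c-exceeded))
      where
      σ-exceeded : Exceeded σ
      σ-exceeded = x , <-by (solve 2 (λ f s → s :+ (:- (s :- f)) := f) refl (form M x) (σ * ‖ x ‖²))
        (0<-x (<-respˡ-≈ (form-shifted σ x) Nx<0))
    ... | coercive ε 0<ε N≥ = contradiction
      (<-by (solve 2 (λ σ ε → (σ :- ε) :+ ε := σ) refl σ ε) 0<ε)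
      (≤⇒≯ (σ-least (σ - ε) λ c (x , c‖x‖²<form) → ≮⇒≥ λ σ-ε<c → ≤⇒≯ (begin
        form M x                      ≈⟨ solve 2 (λ f s → f := s :- (s :- f)) refl (form M x) (σ * ‖ x ‖²) ⟩
        σ * ‖ x ‖² - (σ * ‖ x ‖² - form M x)
          ≤⟨ ≤-by (solve 3 (λ s n e → (s :- n) :+ (n :- e) := s :- e) refl _ _ _)
                (x≤y⇒0≤y-x (≤-trans (N≥ x) (inj₂ (form-shifted σ x)))) ⟩
        σ * ‖ x ‖² - ε * ‖ x ‖²       ≈⟨ solve 3 (λ s e Y → s :* Y :- e :* Y := (s :- e) :* Y) refl σ ε ‖ x ‖² ⟩
        (σ - ε) * ‖ x ‖²              ≤⟨ *-monoʳ-≤ ‖ x ‖² (‖‖²-nonneg x) (inj₁ σ-ε<c) ⟩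
        c * ‖ x ‖²                    ∎) c‖x‖²<form))
      where open ≤-Reasoning

    rayleigh : ∀ {ρ} → IsLargestEigenvalue M ρ → ∀ x → form M x ≤ ρ * ‖ x ‖²
    rayleigh {ρ} (_ , ρ-largest) x = ≮⇒≥ λ ρ‖x‖²<form →
      let σ , ρ<σ , σ-eigenvalue = exceeded⇒eigenvalue ρ (x , ρ‖x‖²<form)
      in ≤⇒≯ (ρ-largest σ σ-eigenvalue) ρ<σ

-- König's theorem for bipartite graphs, by deleting edges.

module König where
  open Data.Nat.Base using (_+_; _≤_; _<_)
  open Sum ℕ.+-*-semiring using (sum; sum-cong-≗; ∑-distrib-+; ∑-comm)
  open ≡ using (refl; sym; trans; cong; cong₂; subst)

  sum-mono-≤ : ∀ {n} {f g : Fin n → ℕ} → (∀ i → f i ≤ g i) → sum f ≤ sum g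
  sum-mono-≤ {zero}  f≤g = z≤n
  sum-mono-≤ {suc n} f≤g = ℕ.+-mono-≤ (f≤g zero) (sum-mono-≤ (f≤g ∘ suc))

  sum-mono-< : ∀ {n} {f g : Fin n → ℕ} → (∀ i → f i ≤ g i) → ∀ i → f i < g i → sum f < sum g
  sum-mono-< f≤g zero    f<g = ℕ.+-mono-<-≤ f<g (sum-mono-≤ (f≤g ∘ suc))
  sum-mono-< f≤g (suc i) f<g = ℕ.+-mono-≤-< (f≤g zero) (sum-mono-< (f≤g ∘ suc) i f<g)

  sum-zero : ∀ {n} {f : Fin n → ℕ} → (∀ i → f i ≡ 0) → sum f ≡ 0
  sum-zero {zero}  f≡0 = refl
  sum-zero {suc n} f≡0 = cong₂ _+_ (f≡0 zero) (sum-zero (f≡0 ∘ suc))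

  term≤sum : ∀ {n} (f : Fin n → ℕ) i → f i ≤ sum f
  term≤sum f zero    = ℕ.m≤m+n (f zero) _
  term≤sum f (suc i) = ℕ.≤-trans (term≤sum (f ∘ suc) i) (ℕ.m≤n+m _ (f zero))

  ι : Bool → ℕ
  ι b = if b then 1 else 0

  size : ∀ {n} → (Fin n → Bool) → ℕ
  size L = sum (λ i → ι (L i))

  size≤1 : ∀ {n} (L : Fin n → Bool) → (∀ i j → L i ≡ true → L j ≡ true → i ≡ j) → size L ≤ 1
  size≤1 {zero}  L unique = z≤n
  size≤1 {suc n} L unique with L zero in L₀
  ... | false = size≤1 (L ∘ suc) (λ i j Li Lj → suc-injective (unique (suc i) (suc j) Li Lj))
  ... | true  = ℕ.≤-reflexive (cong suc (sum-zero rest))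
    where
    rest : ∀ i → ι (L (suc i)) ≡ 0
    rest i with L (suc i) in Lᵢ
    ... | false = refl
    ... | true with () ← unique zero (suc i) L₀ Lᵢ

  BipartiteGraph : ℕ → ℕ → Set
  BipartiteGraph m n = Fin m → Fin n → Bool

  module _ {m n : ℕ} where

    -- The matching is its 0-1 indicator, the row and column sums forcing those values; in this form
    -- it can be averaged with its transpose later.
    record Matching (E : BipartiteGraph m n) (N : ℕ) : Set where
      field
        weight  : Fin m → Fin n → ℕ
        support : ∀ x y → E x y ≡ false → weight x y ≡ 0
        row-sum : ∀ x → sum (weight x) ≤ 1
        col-sum : ∀ y → sum (λ x → weight x y) ≤ 1
        total   : N ≡ sum (λ x → sum (weight x))

    -- Only the upper bound on the size is recorded: no cover is smaller than a matching, so this is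
    -- the nontrivial half of equality.
    record Cover (E : BipartiteGraph m n) (N : ℕ) : Set where
      field
        left   : Fin m → Bool
        right  : Fin n → Bool
        covers : ∀ x y → E x y ≡ true → left x ≡ true ⊎ right y ≡ true
        bound  : size left + size right ≤ N

    TightPair : BipartiteGraph m n → Set
    TightPair E = ∃[ N ] Matching E N × Cover E N

    delete : BipartiteGraph m n → Fin m → Fin n → BipartiteGraph m n
    delete E u v x y = E x y ∧ not (does (x ≟ u) ∧ does (y ≟ v))

    delete-off : ∀ E u v x y → E x y ≡ false → delete E u v x y ≡ false
    delete-off E u v x y Exy rewrite Exy = refl

    delete-left : ∀ E u v x y → x ≢ u → E x y ≡ true → delete E u v x y ≡ true
    delete-left E u v x y x≢u Exy rewrite Exy with x ≟ u
    ... | yes x≡u = contradiction x≡u x≢u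
    ... | no _    = refl

    delete-right : ∀ E u v x y → y ≢ v → E x y ≡ true → delete E u v x y ≡ true
    delete-right E u v x y y≢v Exy rewrite Exy with y ≟ v
    ... | yes y≡v = contradiction y≡v y≢v
    ... | no _    = cong not (Bool.∧-zeroʳ _)

    delete-self : ∀ E u v → delete E u v u v ≡ false
    delete-self E u v with u ≟ u | v ≟ v
    ... | yes _  | yes _  = Bool.∧-zeroʳ _
    ... | no u≢u | _      = contradiction refl u≢u
    ... | _      | no v≢v = contradiction refl v≢v

    edgeCount : BipartiteGraph m n → ℕ
    edgeCount E = sum (λ x → size (E x))

    edgeCount-delete : ∀ E u v → E u v ≡ true → edgeCount (delete E u v) < edgeCount E
    edgeCount-delete E u v Euv =
      sum-mono-< (λ x → sum-mono-≤ (fewer x)) u (sum-mono-< (fewer u) v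
        (ℕ.≤-reflexive (trans (cong (suc ∘ ι) (delete-self E u v)) (cong ι (sym Euv)))))
      where
      fewer : ∀ x y → ι (delete E u v x y) ≤ ι (E x y)
      fewer x y with E x y
      ... | false = z≤n
      ... | true with not (does (x ≟ u) ∧ does (y ≟ v))
      ...   | false = z≤n
      ...   | true  = ℕ.≤-refl

    extend-matching : ∀ {E u v N} → Matching (delete E u v) N → Matching E N
    extend-matching {E} {u} {v} M = record
      { Matching M
      ; support = λ x y Exy → Matching.support M x y (delete-off E u v x y Exy)
      }

    extend-cover : ∀ {E u v N} (C : Cover (delete E u v) N) → Cover.left C u ≡ true → Cover E N
    extend-cover {E} {u} {v} C Lu = record { Cover C ; covers = covers′ }
      where
      covers′ : ∀ x y → E x y ≡ true → Cover.left C x ≡ true ⊎ Cover.right C y ≡ true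
      covers′ x y Exy with x ≟ u
      ... | yes refl = inj₁ Lu
      ... | no x≢u   = Cover.covers C x y (delete-left E u v x y x≢u Exy)

    size-∧-∨ : ∀ {k} (A B : Fin k → Bool) →
               size (λ i → A i ∧ B i) + size (λ i → A i ∨ B i) ≡ size A + size B
    size-∧-∨ A B = trans (sym (∑-distrib-+ (λ i → ι (A i ∧ B i)) (λ i → ι (A i ∨ B i))))
      (trans (sum-cong-≗ (λ i → pointwise (A i) (B i))) (∑-distrib-+ (ι ∘ A) (ι ∘ B)))
      where
      pointwise : ∀ a b → ι (a ∧ b) + ι (a ∨ b) ≡ ι a + ι b
      pointwise false b     = refl
      pointwise true  false = refl
      pointwise true  true  = refl

    size-insert : ∀ {k} (A : Fin k → Bool) u → size (λ i → A i ∨ does (i ≟ u)) ≤ size A + 1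
    size-insert A u = ℕ.≤-trans (ℕ.m≤n+m _ (size (λ i → A i ∧ does (i ≟ u))))
      (ℕ.≤-trans (ℕ.≤-reflexive (size-∧-∨ A (λ i → does (i ≟ u))))
        (ℕ.+-monoʳ-≤ (size A) (size≤1 (λ i → does (i ≟ u)) unique)))
      where
      unique : ∀ i j → does (i ≟ u) ≡ true → does (j ≟ u) ≡ true → i ≡ j
      unique i j _ _ with yes refl ← i ≟ u | yes refl ← j ≟ u = refl

    -- If both exceeded N, their sum would be at least 2N + 2; a surplus of one is therefore
    -- harmless.
    one-of-two≤ : ∀ {a b N} → a + b ≤ N + N + 1 → a ≤ N ⊎ b ≤ N
    one-of-two≤ {a} {b} {N} a+b≤ with a ℕ.≤? N | b ℕ.≤? N
    ... | yes a≤N | _       = inj₁ a≤N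
    ... | no  _   | yes b≤N = inj₂ b≤N
    ... | no  a≰N | no b≰N  = contradiction
      (ℕ.≤-trans (ℕ.+-mono-≤ (ℕ.≰⇒> a≰N) (ℕ.≰⇒> b≰N)) a+b≤)
      (ℕ.<⇒≱ (ℕ.≤-reflexive (cong suc (trans (ℕ.+-comm (N + N) 1) (sym (ℕ.+-suc N N))))))

    -- If u has two neighbours v and w, covers of E - uv and E - uw that both
    -- avoid u contain w and v respectively, so the two lattice combinations
    -- cover E after adding u to one of them.
    combine-covers : ∀ {E u v w N} → v ≢ w →
      (C : Cover (delete E u v) N) (D : Cover (delete E u w) N) → Cover E N
    combine-covers {E} {u} {v} {w} {N} v≢w C D with Cover.left C u in Cu | Cover.left D u in Du
    ... | true  | _     = extend-cover C Cu
    ... | false | true  = extend-cover D Du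
    ... | false | false = pick (one-of-two≤ total)
      where
      open Cover C renaming (left to L; right to R)
      open Cover D renaming (left to L′; right to R′; covers to covers′; bound to bound′)
      L∧ = λ x → L x ∧ L′ x
      L∨ = λ x → L x ∨ L′ x
      L∨u = λ x → L∨ x ∨ does (x ≟ u)
      R∧ = λ y → R y ∧ R′ y
      R∨ = λ y → R y ∨ R′ y

      -- Meets and joins together preserve the total size of the two covers, and inserting u costs
      -- at most 1.
      total : (size L∧ + size R∨) + (size L∨u + size R∧) ≤ N + N + 1
      total = begin
        (size L∧ + size R∨) + (size L∨u + size R∧)
          ≤⟨ ℕ.+-monoʳ-≤ (size L∧ + size R∨) (ℕ.+-monoˡ-≤ (size R∧) (size-insert L∨ u)) ⟩
        (size L∧ + size R∨) + ((size L∨ + 1) + size R∧)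
          ≡⟨ solve 4 (λ a b c d → (a :+ b) :+ ((c :+ con 1) :+ d) := (a :+ c) :+ (d :+ b) :+ con 1)
               refl (size L∧) (size R∨) (size L∨) (size R∧) ⟩
        (size L∧ + size L∨) + (size R∧ + size R∨) + 1
          ≡⟨ cong₂ (λ a b → a + b + 1) (size-∧-∨ L L′) (size-∧-∨ R R′) ⟩
        (size L + size L′) + (size R + size R′) + 1
          ≡⟨ solve 4 (λ a b c d → (a :+ b) :+ (c :+ d) :+ con 1 := (a :+ c) :+ (b :+ d) :+ con 1)
               refl (size L) (size L′) (size R) (size R′) ⟩
        (size L + size R) + (size L′ + size R′) + 1
          ≤⟨ ℕ.+-monoˡ-≤ 1 (ℕ.+-mono-≤ bound bound′) ⟩
        N + N + 1 ∎
        where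
        open ℕ.≤-Reasoning
        open Data.Nat.Solver.+-*-Solver

      ∨-introˡ : ∀ {a b} → a ≡ true → a ∨ b ≡ true
      ∨-introˡ refl = refl

      ∨-introʳ : ∀ {a b} → b ≡ true → a ∨ b ≡ true
      ∨-introʳ {a} refl = Bool.∨-zeroʳ a

      inside : ∀ x y → E x y ≡ true → L∧ x ≡ true ⊎ R∨ y ≡ true
      inside x y Exy with x ≟ u
      ... | no x≢u with covers x y (delete-left E u v x y x≢u Exy)
                      | covers′ x y (delete-left E u w x y x≢u Exy)
      ...   | inj₁ Lx | inj₁ L′x = inj₁ (cong₂ _∧_ Lx L′x)
      ...   | inj₂ Ry | _        = inj₂ (∨-introˡ Ry)
      ...   | inj₁ _  | inj₂ R′y = inj₂ (∨-introʳ {R y} R′y)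
      inside x y Exy | yes refl with y ≟ v
      ... | no y≢v with covers x y (delete-right E u v x y y≢v Exy)
      ...   | inj₁ Lu = contradiction (trans (sym Cu) Lu) λ ()
      ...   | inj₂ Ry = inj₂ (∨-introˡ Ry)
      -- The edge uv survives in E - uw because v ≠ w; the second cover avoids u, so it must contain
      -- v.
      inside x y Exy | yes refl | yes refl with covers′ x y (delete-right E u w x y v≢w Exy)
      ...   | inj₁ L′u = contradiction (trans (sym Du) L′u) λ ()
      ...   | inj₂ R′y = inj₂ (∨-introʳ {R y} R′y)

      outside : ∀ x y → E x y ≡ true → L∨u x ≡ true ⊎ R∧ y ≡ true
      outside x y Exy with x ≟ u
      ... | yes _ = inj₁ (Bool.∨-zeroʳ _)
      ... | no x≢u with covers x y (delete-left E u v x y x≢u Exy)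
                      | covers′ x y (delete-left E u w x y x≢u Exy)
      ...   | inj₁ Lx | _        = inj₁ (∨-introˡ (∨-introˡ Lx))
      ...   | inj₂ _  | inj₁ L′x = inj₁ (∨-introˡ (∨-introʳ {L x} L′x))
      ...   | inj₂ Ry | inj₂ R′y = inj₂ (cong₂ _∧_ Ry R′y)

      pick : size L∧ + size R∨ ≤ N ⊎ size L∨u + size R∧ ≤ N → Cover E N
      pick (inj₁ ≤N) = record { left = L∧ ; right = R∨ ; covers = inside ; bound = ≤N }
      pick (inj₂ ≤N) = record { left = L∨u ; right = R∧ ; covers = outside ; bound = ≤N }

    weaken : ∀ {E N N′} → N ≤ N′ → Cover E N → Cover E N′
    weaken N≤N′ C = record { Cover C ; bound = ℕ.≤-trans (Cover.bound C) N≤N′ }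

    -- The larger of the two matchings is kept; both covers fit within its size, so their
    -- combination does too.
    undelete : ∀ {E u v w} → v ≢ w →
               TightPair (delete E u v) → TightPair (delete E u w) → TightPair E
    undelete v≢w (N , M , C) (N′ , M′ , C′) with ℕ.≤-total N N′
    ... | inj₁ N≤N′ = N′ , extend-matching M′ , combine-covers v≢w (weaken N≤N′ C) C′
    ... | inj₂ N′≤N = N  , extend-matching M  , combine-covers v≢w C (weaken N′≤N C′)

    Branching : BipartiteGraph m n → Set
    Branching E = ∃[ u ] ∃[ v ] ∃[ w ] (E u v ≡ true × E u w ≡ true × v ≢ w)

    branching? : ∀ E → Dec (Branching E)
    branching? E = any? λ u → any? λ v → any? λ w →
      E u v Bool.≟ true ×-dec E u w Bool.≟ true ×-dec ¬? (v ≟ w)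

    unbranched⇒unique : ∀ {E} → ¬ Branching E → ∀ u v w → E u v ≡ true → E u w ≡ true → v ≡ w
    unbranched⇒unique ¬branching u v w Euv Euw with v ≟ w
    ... | yes v≡w = v≡w
    ... | no  v≢w = contradiction (u , v , w , Euv , Euw , v≢w) ¬branching

  -- Exchanging the two sides, and the induction on the number of edges.

  transposeMatching : ∀ {m n N} {E : BipartiteGraph m n} → Matching (flip E) N → Matching E N
  transposeMatching M = record
    { weight  = flip weight
    ; support = flip support
    ; row-sum = col-sum
    ; col-sum = row-sum
    ; total   = trans total (∑-comm weight)
    }
    where open Matching M

  transposeCover : ∀ {m n N} {E : BipartiteGraph m n} → Cover (flip E) N → Cover E N
  transposeCover C = record
    { left   = right
    ; right  = left
    ; covers = λ x y Exy → ⊎.swap (covers y x Exy)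
    ; bound  = ℕ.≤-trans (ℕ.≤-reflexive (ℕ.+-comm (size right) (size left))) bound
    }
    where open Cover C

  -- With all degrees at most 1 on both sides, the edge set is itself a matching, and its left
  -- endpoints form a cover of the same size.
  unbranched : ∀ {m n} (E : BipartiteGraph m n) → ¬ Branching E → ¬ Branching (flip E) → TightPair E
  unbranched {m} {n} E ¬row ¬col = edgeCount E , matching , cover
    where
    matching : Matching E (edgeCount E)
    matching = record
      { weight  = λ x y → ι (E x y)
      ; support = λ x y Exy → cong ι Exy
      ; row-sum = λ x → size≤1 (E x) (unbranched⇒unique ¬row x)
      ; col-sum = λ y → size≤1 (flip E y) (unbranched⇒unique ¬col y)
      ; total   = refl
      }
    hasEdge? : ∀ x → Dec (∃[ y ] E x y ≡ true)
    hasEdge? x = any? (λ y → E x y Bool.≟ true)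
    hasEdge≤size : ∀ x → ι (does (hasEdge? x)) ≤ size (E x)
    hasEdge≤size x with hasEdge? x
    ... | no _          = z≤n
    ... | yes (y , Exy) = ℕ.≤-trans (ℕ.≤-reflexive (sym (cong ι Exy))) (term≤sum (ι ∘ E x) y)
    cover : Cover E (edgeCount E)
    cover = record
      { left   = λ x → does (hasEdge? x)
      ; right  = λ _ → false
      ; covers = λ x y Exy → inj₁ (covered x y Exy)
      ; bound  = ℕ.≤-trans (ℕ.≤-reflexive (trans (cong (size (λ x → does (hasEdge? x)) +_)
                   (sum-zero {n} (λ _ → refl))) (ℕ.+-identityʳ _))) (sum-mono-≤ hasEdge≤size)
      }
      where
      covered : ∀ x y → E x y ≡ true → does (hasEdge? x) ≡ true
      covered x y Exy with hasEdge? x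
      ... | yes _ = refl
      ... | no ¬e = contradiction (y , Exy) ¬e

  -- k is a strict bound on the number of edges, serving as recursion measure. At a vertex with two
  -- neighbours either edge may be deleted, and both smaller graphs are solved; branching on the
  -- right is treated by transposition.
  könig-bounded : ∀ {m n} k (E : BipartiteGraph m n) → edgeCount E < k → TightPair E
  könig-bounded (suc k) E (s≤s e≤k) with branching? E | branching? (flip E)
  ... | yes (u , v , w , Euv , Euw , v≢w) | _ = undelete v≢w
    (könig-bounded k (delete E u v) (ℕ.<-≤-trans (edgeCount-delete E u v Euv) e≤k))
    (könig-bounded k (delete E u w) (ℕ.<-≤-trans (edgeCount-delete E u w Euw) e≤k))
  ... | no _ | yes (u , v , w , Euv , Euw , v≢w) = transpose (undelete v≢w
    (könig-bounded k (delete (flip E) u v) (ℕ.<-≤-trans (edgeCount-delete (flip E) u v Euv) eᵀ≤k))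
    (könig-bounded k (delete (flip E) u w) (ℕ.<-≤-trans (edgeCount-delete (flip E) u w Euw) eᵀ≤k)))
    where
    eᵀ≤k : edgeCount (flip E) ≤ k
    eᵀ≤k = ℕ.≤-trans (ℕ.≤-reflexive (sym (∑-comm (λ x y → ι (E x y))))) e≤k
    transpose : TightPair (flip E) → TightPair E
    transpose (N , M , C) = N , transposeMatching M , transposeCover C
  ... | no ¬row | no ¬col = unbranched E ¬row ¬col

  könig : ∀ {m n} (E : BipartiteGraph m n) → TightPair E
  könig E = könig-bounded (suc (edgeCount E)) E ℕ.≤-refl

-- Indicator functions, cardinalities and degrees as real sums.

module Indicators ⦃ ℝ : Reals ⦄ where
  open OrderedField ⦃ ℝ ⦄

  χ : Bool → Carrier
  χ b = if b then 1# else 0#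

  χ-nonneg : ∀ b → 0# ≤ χ b
  χ-nonneg true  = inj₁ 0<1
  χ-nonneg false = ≤-refl

  χ≤1 : ∀ b → χ b ≤ 1#
  χ≤1 true  = ≤-refl
  χ≤1 false = inj₁ 0<1

  χ² : ∀ b → χ b * χ b ≈ χ b
  χ² true  = *-identityʳ 1#
  χ² false = zeroʳ 0#

  card : ∀ {n} → (Fin n → Bool) → Carrier
  card S = sum (λ i → χ (S i))

  fromℕ-+ : ∀ m n → fromℕ (m ℕ.+ n) ≈ fromℕ m + fromℕ n
  fromℕ-+ = Mult.×-homo-+ semiring 1#

  fromℕ-nonneg : ∀ n → 0# ≤ fromℕ n
  fromℕ-nonneg zero    = ≤-refl
  fromℕ-nonneg (suc n) = +-nonneg (inj₁ 0<1) (fromℕ-nonneg n)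

  fromℕ-mono-≤ : ∀ {m n} → m ℕ.≤ n → fromℕ m ≤ fromℕ n
  fromℕ-mono-≤ {n = n} z≤n = fromℕ-nonneg n
  fromℕ-mono-≤ (s≤s m≤n) = +-mono-≤ ≤-refl (fromℕ-mono-≤ m≤n)

  fromℕ-sum : ∀ {n} (f : Fin n → ℕ) → fromℕ (Sum.sum ℕ.+-*-semiring f) ≈ sum (λ i → fromℕ (f i))
  fromℕ-sum {zero}  f = refl
  fromℕ-sum {suc n} f = trans (fromℕ-+ (f zero) _) (+-congˡ (fromℕ-sum (f ∘ suc)))

  fromℕ-size : ∀ {n} (S : Fin n → Bool) → fromℕ (König.size S) ≈ card S
  fromℕ-size S = trans (fromℕ-sum (λ i → König.ι (S i))) (sum-cong-≋ (λ i → pointwise (S i)))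
    where
    pointwise : ∀ b → fromℕ (König.ι b) ≈ χ b
    pointwise true  = +-identityʳ 1#
    pointwise false = refl

  sum-one : ∀ n → sum {n} (λ _ → 1#) ≈ fromℕ n
  sum-one zero    = refl
  sum-one (suc n) = +-congˡ (sum-one n)

  -- Generalised from `allFin` to `tabulate f`, so that the induction can pass to f ∘ suc.
  fromℕ-length-filter : ∀ {n} {A : Set} {P : A → Set} (P? : ∀ x → Dec (P x)) (f : Fin n → A) →
                        fromℕ (length (filter P? (tabulate f))) ≈ sum (λ i → χ (does (P? (f i))))
  fromℕ-length-filter {zero}  P? f = refl
  fromℕ-length-filter {suc n} P? f with P? (f zero)
  ... | yes _ = +-congˡ (fromℕ-length-filter P? (f ∘ suc))
  ... | no  _ = trans (fromℕ-length-filter P? (f ∘ suc)) (sym (+-identityˡ _))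

  module _ {n} (G : Graph n) where
    open Graph G

    A : Matrix n
    A = adjacencyMatrix G

    A-nonneg : ∀ u v → 0# ≤ A u v
    A-nonneg u v = χ-nonneg (does (u ~? v))

    A-symmetric : ∀ u v → A u v ≈ A v u
    A-symmetric u v with u ~? v | v ~? u
    ... | yes _   | yes _   = refl
    ... | no _    | no _    = refl
    ... | yes u~v | no v≁u  = contradiction (~-sym u~v) v≁u
    ... | no u≁v  | yes v~u = contradiction (~-sym v~u) u≁v

    fromℕ-degree : ∀ v → fromℕ (degree G v) ≈ sum (A v)
    fromℕ-degree v = fromℕ-length-filter (v ~?_) (λ i → i)

    minDegree≤sum : ∀ v → fromℕ (minDegree G) ≤ sum (A v)
    minDegree≤sum v = ≤-trans
      (fromℕ-mono-≤ (All.lookup (min≤xs n (map (degree G) (allFin n))) (∈-map⁺ (degree G) (∈-allFin v))))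
      (inj₂ (fromℕ-degree v))

-- From the bipartite double cover to fractional matchings and barriers.

module FractionalMatchings ⦃ ℝ : Reals ⦄ {n : ℕ} (G : Graph n) where
  open OrderedField ⦃ ℝ ⦄
  open Indicators ⦃ ℝ ⦄
  open Graph G

  -- A symmetric function with zero diagonal is its part above the diagonal plus the transpose of
  -- that part, and both parts have the same total.
  edgeSum-double : ∀ (f : Fin n → Fin n → Carrier) → (∀ u v → f u v ≈ f v u) → (∀ u → f u u ≈ 0#) →
                   2# * edgeSum f ≈ sum (λ u → sum (f u))
  edgeSum-double f f-sym f-diag = sym (begin
    sum (λ u → sum (f u))
      ≈⟨ sum-cong-≋ (λ u → trans (sum-cong-≋ (split u)) (∑-distrib-+ (up u) (λ v → up v u))) ⟩
    sum (λ u → sum (up u) + sum (λ v → up v u))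
      ≈⟨ ∑-distrib-+ (λ u → sum (up u)) (λ u → sum (λ v → up v u)) ⟩
    edgeSum f + sum (λ u → sum (λ v → up v u))
      ≈⟨ +-congˡ (∑-comm (λ u v → up v u)) ⟩
    edgeSum f + edgeSum f
      ≈⟨ solve 1 (λ e → e :+ e := :2 :* e) refl (edgeSum f) ⟩
    2# * edgeSum f ∎)
    where
    open ≈-Reasoning
    up : Fin n → Fin n → Carrier
    up u v = if does (u <? v) then f u v else 0#
    up-< : ∀ {u v} → u <ᶠ v → up u v ≈ f u v
    up-< {u} {v} u<v = reflexive (≡.cong (λ b → if b then f u v else 0#) (dec-true (u <? v) u<v))
    up-≮ : ∀ {u v} → ¬ (u <ᶠ v) → up u v ≈ 0#
    up-≮ {u} {v} u≮v = reflexive (≡.cong (λ b → if b then f u v else 0#) (dec-false (u <? v) u≮v))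
    split : ∀ u v → f u v ≈ up u v + up v u
    split u v with <-cmp u v
    ... | tri< u<v _ v≮u    = sym (trans (+-cong (up-< u<v) (up-≮ v≮u)) (+-identityʳ _))
    ... | tri≈ u≮u ≡.refl _ = trans (f-diag u) (sym (trans (+-cong (up-≮ u≮u) (up-≮ u≮u)) (+-identityˡ 0#)))
    ... | tri> u≮v _ v<u    = trans (f-sym u v) (sym (trans (+-cong (up-≮ u≮v) (up-< v<u)) (+-identityˡ _)))

  doubleCover : König.BipartiteGraph n n
  doubleCover u v = does (u ~? v)

  half : Carrier
  half = 1# / 2#

  0≤half : 0# ≤ half
  0≤half = inj₁ (/-pos 0<1 0<2)

  half*2≈1 : half * 2# ≈ 1#
  half*2≈1 = /-*-cancel 1# 0<2

  doubleCoverMatching⇒edgeSum : ∀ {N} → König.Matching doubleCover N →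
    ∃[ f ] IsFractionalMatching G f × 2# * edgeSum f ≈ fromℕ N
  doubleCoverMatching⇒edgeSum {N} M = f , record
    { symmetric   = f-sym
    ; off-edges   = off
    ; nonneg      = f-nonneg
    ; at-most-one = λ u v → ≤-trans (sum-≤-term (f-nonneg u) v) (f-row u)
    ; vertex-sum  = f-row
    } , (begin
      2# * edgeSum f
        ≈⟨ edgeSum-double f f-sym (λ u → off u u ~-irrefl) ⟩
      sum (λ u → sum (f u))
        ≈⟨ sum-cong-≋ (λ u → trans (*-sum half (λ v → g u v + g v u))
             (*-congˡ (∑-distrib-+ (g u) (λ v → g v u)))) ⟩
      sum (λ u → half * (sum (g u) + sum (λ v → g v u)))
        ≈⟨ trans (*-sum half (λ u → sum (g u) + sum (λ v → g v u)))
             (*-congˡ (∑-distrib-+ (λ u → sum (g u)) (λ u → sum (λ v → g v u)))) ⟩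
      half * (Σg + sum (λ u → sum (λ v → g v u)))
        ≈⟨ *-congˡ (+-congˡ (∑-comm (λ u v → g v u))) ⟩
      half * (Σg + Σg)
        ≈⟨ halve Σg ⟩
      Σg
        ≈⟨ sum-cong-≋ (λ u → fromℕ-sum (weight u)) ⟨
      sum (λ u → fromℕ (Sum.sum ℕ.+-*-semiring (weight u)))
        ≈⟨ fromℕ-sum (λ u → Sum.sum ℕ.+-*-semiring (weight u)) ⟨
      fromℕ (Sum.sum ℕ.+-*-semiring (λ u → Sum.sum ℕ.+-*-semiring (weight u)))
        ≡⟨ ≡.cong fromℕ total ⟨
      fromℕ N ∎)
    where
    open ≈-Reasoning
    open König.Matching M
    g : Fin n → Fin n → Carrier
    g u v = fromℕ (weight u v)
    Σg = sum (λ u → sum (g u))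
    f : Fin n → Fin n → Carrier
    f u v = half * (g u v + g v u)
    halve : ∀ x → half * (x + x) ≈ x
    halve x = trans (solve 2 (λ h x → h :* (x :+ x) := (h :* :2) :* x) refl half x)
      (trans (*-congʳ half*2≈1) (*-identityˡ x))
    f-sym : ∀ u v → f u v ≈ f v u
    f-sym u v = *-congˡ (+-comm (g u v) (g v u))
    g-off : ∀ u v → ¬ (u ~ v) → g u v ≈ 0#
    g-off u v u≁v with u ~? v in u~?v
    ... | yes u~v = contradiction u~v u≁v
    ... | no  _   = reflexive (≡.cong fromℕ (support u v (≡.cong does u~?v)))
    off : ∀ u v → ¬ (u ~ v) → f u v ≈ 0#
    off u v u≁v = trans (*-congˡ (+-cong (g-off u v u≁v) (g-off v u (u≁v ∘ ~-sym))))
      (trans (*-congˡ (+-identityˡ 0#)) (zeroʳ half))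
    f-nonneg : ∀ u v → 0# ≤ f u v
    f-nonneg u v = *-nonneg 0≤half (+-nonneg (fromℕ-nonneg (weight u v)) (fromℕ-nonneg (weight v u)))
    ≤1 : ∀ (h : Fin n → ℕ) → Sum.sum ℕ.+-*-semiring h ℕ.≤ 1 → sum (λ v → fromℕ (h v)) ≤ 1#
    ≤1 h Σh≤1 = ≤-trans (inj₂ (sym (fromℕ-sum h)))
      (≤-trans (fromℕ-mono-≤ Σh≤1) (inj₂ (+-identityʳ 1#)))
    f-row : ∀ u → sum (f u) ≤ 1#
    f-row u = ≤-trans
      (inj₂ (trans (*-sum half (λ v → g u v + g v u)) (*-congˡ (∑-distrib-+ (g u) (λ v → g v u)))))
      (≤-trans (*-monoˡ-≤ half 0≤half
          (+-mono-≤ (≤1 (weight u) (row-sum u)) (≤1 (λ v → weight v u) (col-sum u))))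
        (inj₂ (halve 1#)))

  -- The fractional counterpart of a Tutte-Berge barrier: deleting `S` isolates every vertex of `T`,
  -- and `T` is larger than `S` by at least k.
  record Barrier (k : Carrier) : Set where
    field
      S T       : Fin n → Bool
      disjoint  : ∀ u → T u ≡ true → S u ≡ false
      neighbour : ∀ u v → u ~ v → T u ≡ true → S v ≡ true
      excess    : card S + k ≤ card T
      within    : card S + card T ≤ fromℕ n

  -- A vertex of `T` has neither of its copies in the cover, so both copies of each of its
  -- neighbours must be there. Counting gives |T| + |L| + |R| = n + |S|, while |L| + |R| is at most
  -- twice the weight of a fractional matching, hence at most n - k.
  tightPair⇒barrier : ∀ {k} → König.TightPair doubleCover →
    (∀ f → IsFractionalMatching G f → edgeSum f ≤ (fromℕ n - k) / 2#) → Barrier k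
  tightPair⇒barrier {k} (N , M , C) edgeSum≤ = record
    { S         = S
    ; T         = T
    ; disjoint  = disjoint
    ; neighbour = neighbour
    ; excess    = excess
    ; within    = within
    }
    where
    open König.Cover C renaming (left to L; right to R)
    rearrange : ∀ a b c s t → t + c ≈ a + s → c ≤ a - b → s + b ≤ t
    rearrange a b c s t t+c≈a+s c≤a-b = ≤-by (trans
      (solve 5 (λ a b c s t → (s :+ b) :+ ((a :- b) :- c) := t :+ ((a :+ s) :- (t :+ c))) refl a b c s t)
      (trans (+-congˡ (trans (+-congˡ (-‿cong t+c≈a+s)) (-‿inverseʳ _))) (+-identityʳ t)))
      (x≤y⇒0≤y-x c≤a-b)

    S T : Fin n → Bool
    S u = L u ∧ R u
    T u = not (L u ∨ R u)

    L+R≤n-k : card L + card R ≤ fromℕ n - k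
    L+R≤n-k = let f , f-matching , 2Σf≈N = doubleCoverMatching⇒edgeSum M in begin
      card L + card R                  ≈⟨ +-cong (fromℕ-size L) (fromℕ-size R) ⟨
      fromℕ (König.size L) + fromℕ (König.size R) ≈⟨ fromℕ-+ (König.size L) (König.size R) ⟨
      fromℕ (König.size L ℕ.+ König.size R) ≤⟨ fromℕ-mono-≤ bound ⟩
      fromℕ N                          ≈⟨ 2Σf≈N ⟨
      2# * edgeSum f                   ≤⟨ *-monoˡ-≤ 2# (inj₁ 0<2) (edgeSum≤ f f-matching) ⟩
      2# * ((fromℕ n - k) / 2#)        ≈⟨ *-comm 2# _ ⟩
      (fromℕ n - k) / 2# * 2#          ≈⟨ /-*-cancel (fromℕ n - k) 0<2 ⟩
      fromℕ n - k                      ∎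
      where open ≤-Reasoning

    disjoint : ∀ u → T u ≡ true → S u ≡ false
    disjoint u Tu with L u
    ... | false = ≡.refl
    ... | true with () ← Tu

    neighbour : ∀ u v → u ~ v → T u ≡ true → S v ≡ true
    neighbour u v u~v Tu with covers u v (adjacent u~v) | covers v u (adjacent (~-sym u~v))
      where
      adjacent : ∀ {u v} → u ~ v → does (u ~? v) ≡ true
      adjacent {u} {v} u~v with u ~? v
      ... | yes _  = ≡.refl
      ... | no u≁v = contradiction u~v u≁v
    ... | inj₁ Lu | _       rewrite Lu with () ← Tu
    ... | inj₂ Rv | inj₁ Lv rewrite Lv = Rv
    ... | inj₂ Rv | inj₂ Ru rewrite Ru | Bool.∨-zeroʳ (L u) with () ← Tu

    S+T≤1 : ∀ l r → χ (l ∧ r) + χ (not (l ∨ r)) ≤ 1#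
    S+T≤1 true  r     = ≤-trans (inj₂ (+-identityʳ _)) (χ≤1 r)
    S+T≤1 false r     = ≤-trans (inj₂ (+-identityˡ _)) (χ≤1 (not r))

    T+L+R≈n+S : card T + (card L + card R) ≈ fromℕ n + card S
    T+L+R≈n+S = begin
      card T + (card L + card R)
        ≈⟨ +-congˡ (∑-distrib-+ (χ ∘ L) (χ ∘ R)) ⟨
      card T + sum (λ u → χ (L u) + χ (R u))
        ≈⟨ ∑-distrib-+ (χ ∘ T) (λ u → χ (L u) + χ (R u)) ⟨
      sum (λ u → χ (T u) + (χ (L u) + χ (R u)))
        ≈⟨ sum-cong-≋ (λ u → pointwise (L u) (R u)) ⟩
      sum (λ u → 1# + χ (S u))
        ≈⟨ ∑-distrib-+ (λ _ → 1#) (χ ∘ S) ⟩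
      sum {n} (λ _ → 1#) + card S
        ≈⟨ +-congʳ (sum-one n) ⟩
      fromℕ n + card S ∎
      where
      open ≈-Reasoning
      pointwise : ∀ l r → χ (not (l ∨ r)) + (χ l + χ r) ≈ 1# + χ (l ∧ r)
      pointwise true  r     = +-identityˡ _
      pointwise false true  = trans (+-identityˡ _) (+-comm 0# 1#)
      pointwise false false = +-congˡ (+-identityˡ 0#)

    excess : card S + k ≤ card T
    excess = rearrange (fromℕ n) k (card L + card R) (card S) (card T) T+L+R≈n+S L+R≤n-k

    within : card S + card T ≤ fromℕ n
    within = ≤-trans (inj₂ (sym (∑-distrib-+ (χ ∘ S) (χ ∘ T))))
        (≤-trans (sum-mono-≤ (λ u → S+T≤1 (L u) (R u))) (inj₂ (sum-one n)))

  barrier : ∀ {k} → (∀ f → IsFractionalMatching G f → edgeSum f ≤ (fromℕ n - k) / 2#) → Barrier k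
  barrier = tightPair⇒barrier (König.könig doubleCover)

-- The quadratic form of A_α.

module AαForms ⦃ ℝ : Reals ⦄ {n : ℕ} (G : Graph n) (α : OrderedField.Carrier) where
  open OrderedField ⦃ ℝ ⦄
  open QuadraticForms ⦃ ℝ ⦄
  open Indicators ⦃ ℝ ⦄

  Aα-symmetric : Symmetric (Aα G α)
  Aα-symmetric u v = +-cong (*-congˡ D-symmetric) (*-congˡ (A-symmetric G u v))
    where
    D-symmetric : degreeMatrix G u v ≈ degreeMatrix G v u
    D-symmetric with u ≟ v | v ≟ u
    ... | yes ≡.refl | yes _      = refl
    ... | no _       | no _       = refl
    ... | yes ≡.refl | no v≢v     = contradiction ≡.refl v≢v
    ... | no u≢u     | yes ≡.refl = contradiction ≡.refl u≢u

  degreeMatrix-row : ∀ u (x : Vector n) → degreeMatrix G u ∙ x ≈ sum (A G u) * x u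
  degreeMatrix-row u x = trans (sum-cong-≋ pointwise)
    (trans (sum-single u (λ v → fromℕ (degree G u) * x v)) (*-congʳ (fromℕ-degree G u)))
    where
    pointwise : ∀ v → degreeMatrix G u v * x v ≈ (if does (u ≟ v) then fromℕ (degree G u) * x v else 0#)
    pointwise v with u ≟ v
    ... | yes _ = refl
    ... | no  _ = zeroˡ (x v)

  -- Each degree is distributed over its incident edges, so that the whole form becomes a sum over
  -- ordered adjacent pairs and can be estimated pair by pair.
  form-Aα : ∀ x → form (Aα G α) x ≈
            sum (λ u → sum (λ v → A G u v * (α * (x u * x u) + (1# - α) * (x u * x v))))
  form-Aα x = sum-cong-≋ row
    where
    open ≈-Reasoning
    β = 1# - α
    row : ∀ u → x u * Aα G α u ∙ x ≈ sum (λ v → A G u v * (α * (x u * x u) + β * (x u * x v)))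
    row u = begin
      x u * Aα G α u ∙ x
        ≈⟨ *-congˡ (trans (sum-cong-≋ (λ v →
             solve 5 (λ α d β a y → (α :* d :+ β :* a) :* y := α :* (d :* y) :+ β :* (a :* y))
               refl α (degreeMatrix G u v) β (A G u v) (x v)))
             (sum-linear α β (λ v → degreeMatrix G u v * x v) (λ v → A G u v * x v))) ⟩
      x u * (α * degreeMatrix G u ∙ x + β * A G u ∙ x)
        ≈⟨ *-congˡ (+-congʳ (*-congˡ (degreeMatrix-row u x))) ⟩
      x u * (α * (sum (A G u) * x u) + β * A G u ∙ x)
        ≈⟨ solve 5 (λ y α d β w → y :* (α :* (d :* y) :+ β :* w) := (α :* (y :* y)) :* d :+ (β :* y) :* w)
             refl (x u) α (sum (A G u)) β (A G u ∙ x) ⟩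
      (α * (x u * x u)) * sum (A G u) + (β * x u) * A G u ∙ x
        ≈⟨ sum-linear (α * (x u * x u)) (β * x u) (A G u) (λ v → A G u v * x v) ⟨
      sum (λ v → (α * (x u * x u)) * A G u v + (β * x u) * (A G u v * x v))
        ≈⟨ sum-cong-≋ (λ v → solve 5 (λ α β a y z →
             (α :* (y :* y)) :* a :+ (β :* y) :* (a :* z) := a :* (α :* (y :* y) :+ β :* (y :* z)))
             refl α β (A G u v) (x u) (x v)) ⟩
      sum (λ v → A G u v * (α * (x u * x u) + β * (x u * x v))) ∎

-- Eigenvalue bounds forced by a barrier.

module BarrierBounds ⦃ ℝ : Reals ⦄ {n : ℕ} (G : Graph n) where
  open OrderedField ⦃ ℝ ⦄
  open QuadraticForms ⦃ ℝ ⦄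
  open Indicators ⦃ ℝ ⦄
  open FractionalMatchings ⦃ ℝ ⦄ G using (Barrier)
  open Graph G

  module FromBarrier {k α : Carrier} (0<k : 0# < k) (B : Barrier k) (0≤α : 0# ≤ α) (α≤1 : α ≤ 1#) where
    open Barrier B

    δ s t β : Carrier
    δ = fromℕ (minDegree G)
    s = card S
    t = card T
    β = 1# - α

    0≤β : 0# ≤ β
    0≤β = x≤y⇒0≤y-x α≤1

    0≤δ : 0# ≤ δ
    0≤δ = fromℕ-nonneg (minDegree G)

    0≤s : 0# ≤ s
    0≤s = sum-nonneg (χ-nonneg ∘ S)

    0<t : 0# < t
    0<t = <-≤-trans (+-pos-nonneg 0<k 0≤s) (≤-trans (inj₂ (+-comm k s)) excess)

    T-inhabited : ∃[ u ] T u ≡ true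
    T-inhabited with any? (λ u → T u Bool.≟ true)
    ... | yes u∈T = u∈T
    ... | no ∄u   = contradiction
      (sum-zero (λ u → reflexive (≡.cong χ (Bool.¬-not (λ Tu → ∄u (u , Tu)))))) (pos⇒≉0 0<t)

    A-into-S : ∀ u → T u ≡ true → ∀ v → A G u v ≤ A G u v * χ (S v)
    A-into-S u Tu v with u ~? v
    ... | yes u~v = inj₂ (sym (trans (*-identityˡ _) (reflexive (≡.cong χ (neighbour u v u~v Tu)))))
    ... | no  _   = inj₂ (sym (zeroˡ _))

    -- `T` is inhabited because t > 0, and any vertex of `T` has all of its neighbours, at least δ
    -- many, in `S`.
    δ≤s : δ ≤ s
    δ≤s = let u , Tu = T-inhabited in begin
      δ                              ≤⟨ minDegree≤sum G u ⟩
      sum (A G u)                    ≤⟨ sum-mono-≤ (A-into-S u Tu) ⟩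
      sum (λ v → A G u v * χ (S v))  ≤⟨ sum-mono-≤ (λ v → ≤-trans
        (*-monoʳ-≤ (χ (S v)) (χ-nonneg (S v)) (χ≤1 (does (u ~? v)))) (inj₂ (*-identityˡ _))) ⟩
      s                              ∎
      where open ≤-Reasoning

    -- The number of edges between `T` and `S`, each counted once from its end in `T`.
    cut : Carrier
    cut = sum (λ u → sum (λ v → A G u v * (χ (T u) * χ (S v))))

    cut-transpose : sum (λ u → sum (λ v → A G u v * (χ (S u) * χ (T v)))) ≈ cut
    cut-transpose = trans (∑-comm (λ u v → A G u v * (χ (S u) * χ (T v))))
      (sum-cong-≋ (λ v → sum-cong-≋ (λ u → *-cong (A-symmetric G u v) (*-comm _ _))))

    δt≤cut : δ * t ≤ cut
    δt≤cut = ≤-trans (inj₂ (*-distribˡ-sum δ (χ ∘ T))) (sum-mono-≤ row)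
      where
      row : ∀ u → δ * χ (T u) ≤ sum (λ v → A G u v * (χ (T u) * χ (S v)))
      row u with T u in Tu
      ... | true  = ≤-trans (inj₂ (*-identityʳ δ)) (≤-trans (minDegree≤sum G u)
        (≤-trans (sum-mono-≤ (A-into-S u Tu))
          (inj₂ (sum-cong-≋ (λ v → *-congˡ (sym (*-identityˡ (χ (S v)))))))))
      ... | false = ≤-trans (inj₂ (zeroʳ δ)) (sum-nonneg (λ v →
        *-nonneg (A-nonneg G u v) (*-nonneg ≤-refl (χ-nonneg (S v)))))

    -- Test vectors constant on `S` and on `T`.

    module _ (a b : Carrier) (0≤a : 0# ≤ a) (0≤b : 0# ≤ b) where
      test : Vector n
      test u = a * χ (S u) + b * χ (T u)

      -- Disjointness of `S` and `T` removes the cross term.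
      test² : ∀ u → test u * test u ≈ (a * a) * χ (S u) + (b * b) * χ (T u)
      test² u with T u in Tu
      ... | true rewrite disjoint u Tu =
        solve 2 (λ a b → (a :* con ℤ.0ℤ :+ b :* :1) :* (a :* con ℤ.0ℤ :+ b :* :1)
                      := (a :* a) :* con ℤ.0ℤ :+ (b :* b) :* :1) refl a b
      ... | false = trans
        (solve 3 (λ a b p → (a :* p :+ b :* con ℤ.0ℤ) :* (a :* p :+ b :* con ℤ.0ℤ)
                         := (a :* a) :* (p :* p) :+ (b :* b) :* con ℤ.0ℤ) refl a b (χ (S u)))
        (+-congʳ (*-congˡ (χ² (S u))))

      ‖test‖² : ‖ test ‖² ≈ (a * a) * s + (b * b) * t
      ‖test‖² = trans (sum-cong-≋ test²) (sum-linear (a * a) (b * b) (χ ∘ S) (χ ∘ T))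

      -- The terms of the form at an edge between `S` and `T`: `W₁` for the pair starting in `T`,
      -- `W₂` for the pair starting in `S`.
      W₁ W₂ : Carrier
      W₁ = α * (b * b) + β * (a * b)
      W₂ = α * (a * a) + β * (a * b)

      -- Only edges between `S` and `T` are kept; as a, b, α and β are nonnegative, everything
      -- discarded is nonnegative.
      cut≤form : (W₁ + W₂) * cut ≤ form (Aα G α) test
      cut≤form = begin
        (W₁ + W₂) * cut
          ≈⟨ distribʳ cut W₁ W₂ ⟩
        W₁ * cut + W₂ * cut
          ≈⟨ +-congˡ (*-congˡ cut-transpose) ⟨
        W₁ * cut + W₂ * sum (λ u → sum (ST u))
          ≈⟨ sum-linear W₁ W₂ (λ u → sum (TS u)) (λ u → sum (ST u)) ⟨
        sum (λ u → W₁ * sum (TS u) + W₂ * sum (ST u))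
          ≈⟨ sum-cong-≋ (λ u → sum-linear W₁ W₂ (TS u) (ST u)) ⟨
        sum (λ u → sum (λ v → W₁ * TS u v + W₂ * ST u v))
          ≤⟨ sum-mono-≤ (λ u → sum-mono-≤ (λ v → pointwise u v)) ⟩
        sum (λ u → sum (λ v → A G u v * (α * (test u * test u) + β * (test u * test v))))
          ≈⟨ AαForms.form-Aα G α test ⟨
        form (Aα G α) test ∎
        where
        open ≤-Reasoning
        TS ST : Fin n → Fin n → Carrier
        TS u v = A G u v * (χ (T u) * χ (S v))
        ST u v = A G u v * (χ (S u) * χ (T v))
        pointwise : ∀ u v → W₁ * TS u v + W₂ * ST u v ≤
                            A G u v * (α * (test u * test u) + β * (test u * test v))
        pointwise u v = ≤-trans (≤-by
          -- The added summand is what was discarded: degree terms whose other end lies outside the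
          -- opposite set, and products within `S` or within `T`.
          (solve 9 (λ α β a b e p q p′ q′ →
              ((α :* (b :* b) :+ β :* (a :* b)) :* (e :* (q :* p′))
                :+ (α :* (a :* a) :+ β :* (a :* b)) :* (e :* (p :* q′)))
              :+ e :* (α :* ((a :* a) :* (p :* (:1 :- q′)) :+ (b :* b) :* (q :* (:1 :- p′)))
                       :+ β :* ((a :* a) :* (p :* p′) :+ (b :* b) :* (q :* q′)))
              := e :* (α :* ((a :* a) :* p :+ (b :* b) :* q)
                       :+ β :* ((a :* p :+ b :* q) :* (a :* p′ :+ b :* q′))))
            refl α β a b (A G u v) (χ (S u)) (χ (T u)) (χ (S v)) (χ (T v)))
          (*-nonneg (A-nonneg G u v) (+-nonneg
            (*-nonneg 0≤α (+-nonneg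
              (*-nonneg (x²-nonneg a) (*-nonneg (χ-nonneg (S u)) (x≤y⇒0≤y-x (χ≤1 (T v)))))
              (*-nonneg (x²-nonneg b) (*-nonneg (χ-nonneg (T u)) (x≤y⇒0≤y-x (χ≤1 (S v)))))))
            (*-nonneg 0≤β (+-nonneg
              (*-nonneg (x²-nonneg a) (*-nonneg (χ-nonneg (S u)) (χ-nonneg (S v))))
              (*-nonneg (x²-nonneg b) (*-nonneg (χ-nonneg (T u)) (χ-nonneg (T v)))))))))
          (inj₂ (*-congˡ (+-congʳ (*-congˡ (sym (test² u))))))

      test-bound : ∀ {ρ} → IsLargestEigenvalue (Aα G α) ρ →
                   (W₁ + W₂) * (δ * t) ≤ ρ * ((a * a) * s + (b * b) * t)
      test-bound {ρ} ρ-largest = begin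
        (W₁ + W₂) * (δ * t)                   ≤⟨ *-monoˡ-≤ (W₁ + W₂) 0≤W δt≤cut ⟩
        (W₁ + W₂) * cut                       ≤⟨ cut≤form ⟩
        form (Aα G α) test                    ≤⟨ rayleigh (Aα G α) (AαForms.Aα-symmetric G α) ρ-largest test ⟩
        ρ * ‖ test ‖²                         ≈⟨ *-congˡ ‖test‖² ⟩
        ρ * ((a * a) * s + (b * b) * t)       ∎
        where
        open ≤-Reasoning
        0≤W : 0# ≤ W₁ + W₂
        0≤W = +-nonneg
          (+-nonneg (*-nonneg 0≤α (x²-nonneg b)) (*-nonneg 0≤β (*-nonneg 0≤a 0≤b)))
          (+-nonneg (*-nonneg 0≤α (x²-nonneg a)) (*-nonneg 0≤β (*-nonneg 0≤a 0≤b)))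

    -- Lower bounds for the largest eigenvalue of A_α(G).

    module _ {ρ : Carrier} (ρ-largest : IsLargestEigenvalue (Aα G α) ρ) where

      -- The indicator of `T` gives αδt ≤ ρt. The sign allows r * s ≤ t to be multiplied by ρ below.
      0≤ρ : 0# ≤ ρ
      0≤ρ = *-cancelˡ-≤ t 0<t (begin
        t * 0#                                    ≈⟨ zeroʳ t ⟩
        0#                                        ≤⟨ *-nonneg 0≤α (*-nonneg 0≤δ (inj₁ 0<t)) ⟩
        α * (δ * t)                               ≈⟨ solve 3 (λ α β d →
            α :* d := ((α :* (:1 :* :1) :+ β :* (con ℤ.0ℤ :* :1))
                      :+ (α :* (con ℤ.0ℤ :* con ℤ.0ℤ) :+ β :* (con ℤ.0ℤ :* :1))) :* d) refl α β (δ * t) ⟩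
        (W₁ 0# 1# ≤-refl (inj₁ 0<1) + W₂ 0# 1# ≤-refl (inj₁ 0<1)) * (δ * t)
          ≤⟨ test-bound 0# 1# ≤-refl (inj₁ 0<1) ρ-largest ⟩
        ρ * ((0# * 0#) * s + (1# * 1#) * t)       ≈⟨ solve 3 (λ ρ s t →
            ρ :* ((con ℤ.0ℤ :* con ℤ.0ℤ) :* s :+ (:1 :* :1) :* t) := t :* ρ) refl ρ s t ⟩
        t * ρ                                     ∎)
        where open ≤-Reasoning

      -- With (a , b) = (σ , 1) the weights add up to 2σ, and σ² s ≤ t bounds the squared norm by
      -- 2t.
      bound-zero : α ≈ 0# → ∀ {r σ} → 0# ≤ σ → σ * σ ≈ r → r * s ≤ t → δ * σ ≤ ρ
      bound-zero α≈0 {r} {σ} 0≤σ σ²≈r rs≤t = *-cancelˡ-≤ (2# * t) (*-positive 0<2 0<t) (begin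
        (2# * t) * (δ * σ)
          ≈⟨ solve 3 (λ t δ σ → (:2 :* t) :* (δ :* σ) := (:2 :* σ) :* (δ :* t)) refl t δ σ ⟩
        (2# * σ) * (δ * t)
          ≈⟨ *-congʳ (trans (+-cong (W≈σ (1# * 1#)) (W≈σ (σ * σ)))
               (solve 1 (λ σ → σ :+ σ := :2 :* σ) refl σ)) ⟨
        (α * (1# * 1#) + β * (σ * 1#) + (α * (σ * σ) + β * (σ * 1#))) * (δ * t)
          ≤⟨ test-bound σ 1# 0≤σ (inj₁ 0<1) ρ-largest ⟩
        ρ * ((σ * σ) * s + (1# * 1#) * t)
          ≤⟨ *-monoˡ-≤ ρ 0≤ρ (+-mono-≤ (≤-trans (inj₂ (*-congʳ σ²≈r)) rs≤t) ≤-refl) ⟩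
        ρ * (t + (1# * 1#) * t)
          ≈⟨ solve 2 (λ ρ t → ρ :* (t :+ (:1 :* :1) :* t) := (:2 :* t) :* ρ) refl ρ t ⟩
        (2# * t) * ρ ∎)
        where
        open ≤-Reasoning
        W≈σ : ∀ y → α * y + β * (σ * 1#) ≈ σ
        W≈σ y = trans (+-cong (*-congʳ α≈0) (*-congʳ (+-congˡ (-‿cong α≈0))))
          (solve 2 (λ y σ → con ℤ.0ℤ :* y :+ (:1 :- con ℤ.0ℤ) :* (σ :* :1) := σ) refl y σ)

      -- With (a , b) = (r , 1) the squared norm is at most (r + 1)t, and the weights exceed α(r +
      -- 1)² by 2(1 - 2α)r, which is nonnegative exactly in this range of α when r > 0.
      bound-small : α * 2# ≤ 1# → ∀ {r} → 0# ≤ r → r * s ≤ t → α * δ * (r + 1#) ≤ ρ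
      bound-small 2α≤1 {r} 0≤r rs≤t = *-cancelˡ-≤ ((r + 1#) * t) (*-positive (0<x+1 0≤r) 0<t) (begin
        ((r + 1#) * t) * (α * δ * (r + 1#))
          ≈⟨ solve 4 (λ r t α δ → ((r :+ :1) :* t) :* (α :* δ :* (r :+ :1))
               := (α :* ((r :+ :1) :* (r :+ :1))) :* (δ :* t)) refl r t α δ ⟩
        (α * ((r + 1#) * (r + 1#))) * (δ * t)
          ≤⟨ *-monoʳ-≤ (δ * t) (*-nonneg 0≤δ (inj₁ 0<t)) (≤-by
               (solve 2 (λ α r → α :* ((r :+ :1) :* (r :+ :1)) :+ :2 :* ((:1 :- α :* :2) :* r)
                 := (α :* (:1 :* :1) :+ (:1 :- α) :* (r :* :1)) :+ (α :* (r :* r) :+ (:1 :- α) :* (r :* :1)))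
                 refl α r)
               (*-nonneg (inj₁ 0<2) (*-nonneg (x≤y⇒0≤y-x 2α≤1) 0≤r))) ⟩
        (α * (1# * 1#) + β * (r * 1#) + (α * (r * r) + β * (r * 1#))) * (δ * t)
          ≤⟨ test-bound r 1# 0≤r (inj₁ 0<1) ρ-largest ⟩
        ρ * ((r * r) * s + (1# * 1#) * t)
          ≤⟨ *-monoˡ-≤ ρ 0≤ρ (+-mono-≤ (≤-trans (inj₂ (*-assoc r r s)) (*-monoˡ-≤ r 0≤r rs≤t)) ≤-refl) ⟩
        ρ * (r * t + (1# * 1#) * t)
          ≈⟨ solve 3 (λ ρ r t → ρ :* (r :* t :+ (:1 :* :1) :* t) := ((r :+ :1) :* t) :* ρ) refl ρ r t ⟩
        ((r + 1#) * t) * ρ ∎)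
        where
        open ≤-Reasoning

      -- The indicator of `S` gives αδt ≤ ρs; multiplication by r turns s into at most t.
      bound-large : ∀ {r} → 0# ≤ r → r * s ≤ t → α * δ * r ≤ ρ
      bound-large {r} 0≤r rs≤t = *-cancelˡ-≤ t 0<t (begin
        t * (α * δ * r)
          ≈⟨ solve 5 (λ α β δ t r → t :* (α :* δ :* r) := r :*
               (((α :* (con ℤ.0ℤ :* con ℤ.0ℤ) :+ β :* (:1 :* con ℤ.0ℤ))
                :+ (α :* (:1 :* :1) :+ β :* (:1 :* con ℤ.0ℤ))) :* (δ :* t))) refl α β δ t r ⟩
        r * ((α * (0# * 0#) + β * (1# * 0#) + (α * (1# * 1#) + β * (1# * 0#))) * (δ * t))
          ≤⟨ *-monoˡ-≤ r 0≤r (test-bound 1# 0# (inj₁ 0<1) ≤-refl ρ-largest) ⟩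
        r * (ρ * ((1# * 1#) * s + (0# * 0#) * t))
          ≈⟨ solve 4 (λ r ρ s t → r :* (ρ :* ((:1 :* :1) :* s :+ (con ℤ.0ℤ :* con ℤ.0ℤ) :* t))
               := ρ :* (r :* s)) refl r ρ s t ⟩
        ρ * (r * s)
          ≤⟨ *-monoˡ-≤ ρ 0≤ρ rs≤t ⟩
        ρ * t
          ≈⟨ *-comm ρ t ⟩
        t * ρ ∎)
        where open ≤-Reasoning

    -- `T` is independent in `G`, hence a clique in the complement. Each ordered pair of distinct
    -- vertices of `T` contributes α + β = 1 to the form, and the separate t accounts for the
    -- diagonal pairs.
    clique≤form : t * t ≤ form (Aα (complement G) α) (χ ∘ T) + t
    clique≤form = begin
      t * t
        ≈⟨ *-distribʳ-sum t (χ ∘ T) ⟩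
      sum (λ u → χ (T u) * t)
        ≈⟨ sum-cong-≋ (λ u → *-distribˡ-sum (χ (T u)) (χ ∘ T)) ⟩
      sum (λ u → sum (λ v → χ (T u) * χ (T v)))
        ≤⟨ sum-mono-≤ (λ u → sum-mono-≤ (λ v → pointwise u v)) ⟩
      sum (λ u → sum (λ v → F u v + I u v))
        ≈⟨ sum-cong-≋ (λ u → ∑-distrib-+ (F u) (I u)) ⟩
      sum (λ u → sum (F u) + sum (I u))
        ≈⟨ ∑-distrib-+ (λ u → sum (F u)) (λ u → sum (I u)) ⟩
      sum (λ u → sum (F u)) + sum (λ u → sum (I u))
        ≈⟨ +-cong (sym (AαForms.form-Aα H α (χ ∘ T))) (sum-cong-≋ (λ u → sum-single u (χ ∘ T))) ⟩
      form (Aα H α) (χ ∘ T) + t ∎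
      where
      open ≤-Reasoning
      H = complement G
      F I : Fin n → Fin n → Carrier
      F u v = A H u v * (α * (χ (T u) * χ (T u)) + β * (χ (T u) * χ (T v)))
      I u v = if does (u ≟ v) then χ (T v) else 0#

      F-nonneg : ∀ u v → 0# ≤ F u v
      F-nonneg u v = *-nonneg (A-nonneg H u v) (+-nonneg (*-nonneg 0≤α (x²-nonneg _))
        (*-nonneg 0≤β (*-nonneg (χ-nonneg (T u)) (χ-nonneg (T v)))))
      I-nonneg : ∀ u v → 0# ≤ I u v
      I-nonneg u v with u ≟ v
      ... | yes _ = χ-nonneg (T v)
      ... | no  _ = ≤-refl

      independent : ∀ u v → T u ≡ true → T v ≡ true → ¬ (u ~ v)
      independent u v Tu Tv u~v with () ← ≡.trans (≡.sym (neighbour u v u~v Tu)) (disjoint v Tv)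

      pointwise : ∀ u v → χ (T u) * χ (T v) ≤ F u v + I u v
      pointwise u v = by-cases u v (T u Bool.≟ true) (T v Bool.≟ true) (u ≟ v)
        where
        by-cases : ∀ u v → Dec (T u ≡ true) → Dec (T v ≡ true) → Dec (u ≡ v) →
                   χ (T u) * χ (T v) ≤ F u v + I u v
        by-cases u v (no Tu≢) _ _ = ≤-trans
          (inj₂ (trans (*-congʳ (reflexive (≡.cong χ (Bool.¬-not Tu≢)))) (zeroˡ _)))
          (+-nonneg (F-nonneg u v) (I-nonneg u v))
        by-cases u v (yes _) (no Tv≢) _ = ≤-trans
          (inj₂ (trans (*-congˡ (reflexive (≡.cong χ (Bool.¬-not Tv≢)))) (zeroʳ _)))
          (+-nonneg (F-nonneg u v) (I-nonneg u v))
        by-cases u _ (yes _) (yes _) (yes ≡.refl) = begin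
          χ (T u) * χ (T u)   ≈⟨ χ² (T u) ⟩
          χ (T u)             ≡⟨ ≡.cong (λ b → if b then χ (T u) else 0#) (dec-true (u ≟ u) ≡.refl) ⟨
          I u u               ≤⟨ ≤-by (+-comm _ _) (F-nonneg u u) ⟩
          F u u + I u u       ∎
        by-cases u v (yes Tu) (yes Tv) (no u≢v) = begin
          χ (T u) * χ (T v)
            ≈⟨ *-cong (reflexive (≡.cong χ Tu)) (reflexive (≡.cong χ Tv)) ⟩
          1# * 1#
            ≈⟨ solve 1 (λ α → :1 :* :1 := :1 :* (α :* (:1 :* :1) :+ (:1 :- α) :* (:1 :* :1))) refl α ⟩
          1# * (α * (1# * 1#) + β * (1# * 1#))
            ≈⟨ *-cong (reflexive (≡.cong χ (dec-true (Graph._~?_ H u v) (u≢v , independent u v Tu Tv))))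
                 (+-cong (*-congˡ (*-cong (reflexive (≡.cong χ Tu)) (reflexive (≡.cong χ Tu))))
                         (*-congˡ (*-cong (reflexive (≡.cong χ Tu)) (reflexive (≡.cong χ Tv))))) ⟨
          F u v
            ≤⟨ ≤-by refl (I-nonneg u v) ⟩
          F u v + I u v ∎

    -- The clique gives t(t - 1) ≤ ρt, and t ≥ s + k ≥ δ + k.
    bound-complement : ∀ {ρ} → IsLargestEigenvalue (Aα (complement G) α) ρ → (δ + k) - 1# ≤ ρ
    bound-complement {ρ} ρ-largest = *-cancelˡ-≤ t 0<t (begin
      t * ((δ + k) - 1#)
        ≤⟨ *-monoˡ-≤ t (inj₁ 0<t) (+-mono-≤ (≤-trans (+-mono-≤ δ≤s ≤-refl) excess) ≤-refl) ⟩
      t * (t - 1#)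
        ≈⟨ solve 1 (λ t → t :* (t :- :1) := t :* t :- t) refl t ⟩
      t * t - t
        ≤⟨ +-mono-≤ clique≤form ≤-refl ⟩
      (Φ + t) - t
        ≈⟨ solve 2 (λ Φ t → (Φ :+ t) :- t := Φ) refl Φ t ⟩
      Φ
        ≤⟨ rayleigh (Aα (complement G) α) (AαForms.Aα-symmetric (complement G) α) ρ-largest (χ ∘ T) ⟩
      ρ * ‖ χ ∘ T ‖²
        ≈⟨ trans (*-congˡ (sum-cong-≋ (λ u → χ² (T u)))) (*-comm ρ t) ⟩
      t * ρ ∎)
      where
      open ≤-Reasoning
      Φ = form (Aα (complement G) α) (χ ∘ T)

    -- The ratio r = (n + k) / (n - k).

    module _ (k<n : k < fromℕ n) where
      d r : Carrier
      d = fromℕ n - k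
      r = (fromℕ n + k) / d

      0<d : 0# < d
      0<d = x<y⇒0<y-x k<n

      0≤r : 0# ≤ r
      0≤r = *-nonneg (+-nonneg (fromℕ-nonneg n) (inj₁ 0<k)) (inj₁ (⁻¹-pos 0<d))

      rs≤t : r * s ≤ t
      rs≤t = *-cancelˡ-≤ d 0<d (begin
        d * (r * s)              ≈⟨ solve 3 (λ d r s → d :* (r :* s) := (r :* d) :* s) refl d r s ⟩
        (r * d) * s              ≈⟨ *-congʳ (/-*-cancel (fromℕ n + k) 0<d) ⟩
        (fromℕ n + k) * s        ≤⟨ cross (fromℕ n) k s t (fromℕ-nonneg n) (inj₁ 0<k) excess within ⟩
        d * t                    ∎)
        where
        open ≤-Reasoning
        cross : ∀ n k s t → 0# ≤ n → 0# ≤ k → s + k ≤ t → s + t ≤ n → (n + k) * s ≤ (n - k) * t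
        cross n k s t 0≤n 0≤k s+k≤t s+t≤n = ≤-by
          -- The difference of the two sides is n times the slack in s + k ≤ t plus k times the
          -- slack in s + t ≤ n.
          (solve 4 (λ n k s t → (n :+ k) :* s :+ (n :* (t :- (s :+ k)) :+ k :* (n :- (s :+ t)))
                             := (n :- k) :* t) refl n k s t)
          (+-nonneg (*-nonneg 0≤n (x≤y⇒0≤y-x s+k≤t)) (*-nonneg 0≤k (x≤y⇒0≤y-x s+t≤n)))

      d/d≈1 : d / d ≈ 1#
      d/d≈1 = ⁻¹-inverse d (pos⇒≉0 0<d)

      1+2k/d≈r : 1# + (2# * k) / d ≈ r
      1+2k/d≈r = trans (+-congʳ (sym d/d≈1))
        (solve 3 (λ n k i → (n :- k) :* i :+ (:2 :* k) :* i := (n :+ k) :* i) refl (fromℕ n) k (d ⁻¹))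

      αδ[r+1]≈ : α * δ * (r + 1#) ≈ (2# * α * δ * fromℕ n) / d
      αδ[r+1]≈ = trans (*-congˡ (+-congˡ (sym d/d≈1)))
        (solve 5 (λ α δ n k i → α :* δ :* ((n :+ k) :* i :+ (n :- k) :* i) := (:2 :* α :* δ :* n) :* i)
           refl α δ (fromℕ n) k (d ⁻¹))

-- The four spectral conditions.

open import Defs

corollary1p6 :
    ⦃ ℝ : Reals ⦄ (n : ℕ) (G : Graph n) → Connected G →
    let n′ = fromℕ n
        δ  = fromℕ (minDegree G)
        2# = fromℕ 2 in
    (k : Carrier) → 0# < k → k < n′ → δ ≤ (n′ - k) / 2# →
    (α : Carrier) → 0# ≤ α → α ≤ 1# →
    (μ : Carrier) → IsFractionalMatchingNumber G μ →
    (α ≈ 0# →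
      (ρ : Carrier) → IsLargestEigenvalue (Aα G α) ρ →
      (s : Carrier) → IsSqrtOf s (1# + (2# * k) / (n′ - k)) →
      ρ < δ * s →
      (n′ - k) / 2# < μ)
    ×
    (0# < α → α ≤ 1# / 2# →
      (ρ : Carrier) → IsLargestEigenvalue (Aα G α) ρ →
      ρ < (2# * α * δ * n′) / (n′ - k) →
      (n′ - k) / 2# < μ)
    ×
    (1# / 2# < α →
      (ρ : Carrier) → IsLargestEigenvalue (Aα G α) ρ →
      ρ < (α * δ * (n′ + k)) / (n′ - k) →
      (n′ - k) / 2# < μ)
    ×
    ((ρ : Carrier) → IsLargestEigenvalue (Aα (complement G) α) ρ →
      ρ < (δ + k) - 1# →
      (n′ - k) / 2# < μ)
corollary1p6 ⦃ ℝ ⦄ n G _ k 0<k k<n _ α 0≤α α≤1 μ (_ , edgeSum≤μ) =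
    (λ α≈0 ρ ρ-largest s (0≤s , s²≈) ρ< → unless λ B →
      let open Bounds B using (bound-zero; 1+2k/d≈r; rs≤t) in
      ≤⇒≯ (bound-zero ρ-largest α≈0 0≤s (trans s²≈ (1+2k/d≈r k<n)) (rs≤t k<n)) ρ<)
  , (λ _ α≤1/2 ρ ρ-largest ρ< → unless λ B →
      let open Bounds B using (bound-small; αδ[r+1]≈; 0≤r; rs≤t) in
      ≤⇒≯ (bound-small ρ-largest (2α≤1 α≤1/2) (0≤r k<n) (rs≤t k<n)) (<-respʳ-≈ (sym (αδ[r+1]≈ k<n)) ρ<))
  , (λ _ ρ ρ-largest ρ< → unless λ B → let open Bounds B using (bound-large; 0≤r; rs≤t) in
      ≤⇒≯ (bound-large ρ-largest (0≤r k<n) (rs≤t k<n)) (<-respʳ-≈ (*-assoc _ _ _) ρ<))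
  , (λ ρ ρ-largest ρ< → unless λ B → let open Bounds B using (bound-complement) in
      ≤⇒≯ (bound-complement ρ-largest) ρ<)
  where
  open OrderedField ⦃ ℝ ⦄
    using (≤⇒≯; ≤-trans; ≤-<-connex; <-respʳ-≈; trans; sym; *-assoc; *-monoʳ-≤; /-*-cancel; 0<2)
  open FractionalMatchings ⦃ ℝ ⦄ G using (Barrier; barrier)
  module Bounds (B : Barrier k) = BarrierBounds.FromBarrier ⦃ ℝ ⦄ G 0<k B 0≤α α≤1

  -- By contraposition: μ ≤ (n - k) / 2 bounds the weight of every fractional matching and so yields
  -- a barrier, which each spectral hypothesis refutes.
  unless : ¬ Barrier k → (fromℕ n - k) / fromℕ 2 < μ
  unless ¬B with ≤-<-connex μ ((fromℕ n - k) / fromℕ 2)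
  ... | inj₂ <μ = <μ
  ... | inj₁ μ≤ = contradiction (barrier λ f f-matching → ≤-trans (edgeSum≤μ f f-matching) μ≤) ¬B

  2α≤1 : α ≤ 1# / fromℕ 2 → α * fromℕ 2 ≤ 1#
  2α≤1 α≤1/2 = ≤-trans (*-monoʳ-≤ (fromℕ 2) (inj₁ 0<2) α≤1/2) (inj₂ (/-*-cancel 1# 0<2))
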